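{- For every graph $G$, $$2\,\mathrm{lrw}(G)\le \mathrm{lsfw}(G)\le 2^{\mathrm{lrw}(G)+1}.$$ In particular, $\mathrm{lrw}(G)\le 1$ implies $\mathrm{lsfw}(G)\le 4$, and $\mathrm{lrw}(G)\le 2$ implies $\mathrm{lsfw}(G)\le 8$.
   Context: All graphs are finite, simple and undirected. Both parameters are assigned value $0$ on the empty graph. Linear rank-width. For $X\subseteq V(G)$ the cutrank $\rho_G(X)$ is the rank over $\mathbb F_2$ of the $X\times (V(G)\setminus X)$ adjacency matrix. For a linear order $\pi=(v_1,\dots,v_n)$ of $V(G)$ put $P_i=\{v_1,\dots,v_i\}$ for $0\le i\le n$. Then $\mathrm{lrw}(G)=\min_\pi\max_i\rho_G(P_i)$, the minimum over all linear orders $\pi$ of $V(G)$. Sequential cable plays. A configuration on $G$ consists of the set of born vertices, a family $\mathcal L$ of pairwise disjoint nonempty sets of born vertices (the live cables), and a set of already placed edges; initially all are empty. With $\ell=|\mathcal L|$ the number of live cables before a move, the moves are: (i) birth$(S)$: introduces a nonempty set $S$ of fresh (not yet born) vertices of $G$ as one live cable; cost $2\ell+1$. (ii) fold$(X,Y)$: replaces two distinct live cables $X,Y$ by $X\cup Y$; cost $2\ell-1$. (iii) block$(X,Y)$: places every edge between two distinct live cables $X,Y$; legal when all these pairs are edges of $G$ and at least one has not already been placed; cost $2\ell$. (iv) clique$(X)$: places every edge inside a live cable $X$; legal when $X$ is a clique of $G$ and at least one internal edge has not already been placed; cost $2\ell$. (v) close$(X)$: removes the live cable $X$; legal when every edge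 of $G$ incident with a vertex of $X$ has already been placed; cost $2\ell-1$. A play (a finite sequence of legal moves from the initial configuration) constructs $G$ if every vertex is born, every edge of $G$ is placed, and every cable is closed. The width of a play is the maximum cost of its moves, and $\mathrm{lsfw}(G)$ is the minimum width of a play constructing $G$. -}

module Defs where

open import Algebra.Bundles using (CommutativeRing)
open import Data.Bool using (Bool; true; false; _∧_; _∨_)
open import Data.Bool.Properties using (xor-∧-commutativeRing)
open import Data.Fin using (Fin; toℕ)
open import Data.Fin.Permutation using (Permutation′; _⟨$⟩ˡ_)
open import Data.Fin.Subset as Subset
  using (Subset; _∈_; _∉_; _⊆_; _∪_; ∁; ∣_∣; Nonempty)
open import Data.List using (List; []; _∷_; length)
import Data.List.Membership.Propositional as List
open import Data.List.Relation.Unary.Any using (_─_)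
open import Data.Nat using (ℕ; suc; _+_; _*_; _∸_; _⊔_; _≤_; _<?_)
open import Data.Nat.Properties using (≤-antisym)
open import Data.Product using (Σ; ∃; _×_; _,_)
open import Data.Vec using (lookup; tabulate)
open import Relation.Binary.Construct.Closure.ReflexiveTransitive
  using (Star; ε; _◅_)
open import Relation.Binary.PropositionalEquality using (_≡_; _≢_)
open import Relation.Nullary using (does)

open import Algebra.Properties.CommutativeMonoid.Sum
  (CommutativeRing.+-commutativeMonoid xor-∧-commutativeRing)
  using () renaming (sum to ⊕-sum)

IsMinimum : (ℕ → Set) → ℕ → Set
IsMinimum P m = P m × (∀ k → P k → m ≤ k)

IsMaximum : (ℕ → Set) → ℕ → Set
IsMaximum P m = P m × (∀ k → P k → k ≤ m)

IsMinimum-unique : ∀ {P m m′} → IsMinimum P m → IsMinimum P m′ → m ≡ m′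
IsMinimum-unique (p , min) (p′ , min′) = ≤-antisym (min _ p′) (min′ _ p)

-- Finite simple graphs on the vertex set Fin n.  The Boolean adjacency
-- function is at the same time the adjacency matrix over 𝔽₂, where 𝔽₂ is Bool
-- with xor as addition and ∧ as multiplication.

record Graph (n : ℕ) : Set where
  field
    adj       : Fin n → Fin n → Bool
    symmetric : ∀ u v → adj u v ≡ adj v u
    loopless  : ∀ v → adj v v ≡ false

open Graph public

------------------------------------------------------------------------
-- Linear rank-width

-- Linear independence over 𝔽₂ of the rows of M indexed by R, each restricted
-- to the columns in Y.  A coefficient vector c on R is extended by zero.

IndependentRows : ∀ {n} → (Fin n → Fin n → Bool) → Subset n → Subset n → Set
IndependentRows {n} M R Y =
  ∀ (c : Fin n → Bool) →
  (∀ i → i ∉ R → c i ≡ false) →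
  (∀ j → j ∈ Y → ⊕-sum (λ i → c i ∧ M i j) ≡ false) →
  ∀ i → c i ≡ false

-- r is the rank over 𝔽₂ of the X × Y submatrix of M: the largest number of
-- linearly independent rows.

IsRank : ∀ {n} → (Fin n → Fin n → Bool) → Subset n → Subset n → ℕ → Set
IsRank {n} M X Y =
  IsMaximum (λ r → Σ (Subset n) λ R → R ⊆ X × IndependentRows M R Y × ∣ R ∣ ≡ r)

IsCutrank : ∀ {n} → Graph n → Subset n → ℕ → Set
IsCutrank G X = IsRank (adj G) X (∁ X)

-- A linear order of the vertices is a permutation π sending (0-based)
-- positions to vertices, so  π ⟨$⟩ˡ v  is the position of v, and prefix π i
-- consists of the first i vertices.

prefix : ∀ {n} → Permutation′ n → ℕ → Subset n
prefix π i = tabulate λ v → does (toℕ (π ⟨$⟩ˡ v) <? i)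

IsOrderWidth : ∀ {n} → Graph n → Permutation′ n → ℕ → Set
IsOrderWidth {n} G π =
  IsMaximum (λ r → Σ (Fin (suc n)) λ i → IsCutrank G (prefix π (toℕ i)) r)

IsLrw : ∀ {n} → Graph n → ℕ → Set
IsLrw {n} G = IsMinimum (λ w → Σ (Permutation′ n) λ π → IsOrderWidth G π w)

------------------------------------------------------------------------
-- Sequential cable plays

-- In every configuration reachable from the initial one, the live cables are
-- pairwise disjoint nonempty sets of born vertices.  Hence listing the family
-- is harmless: the order of the list is irrelevant to the moves, and distinct
-- list entries are distinct cables.

record Config (n : ℕ) : Set where
  constructor config
  field
    born   : Subset n
    live   : List (Subset n)
    placed : Fin n → Fin n → Bool

open Config public

initial : ∀ {n} → Config n
initial = config Subset.⊥ [] (λ _ _ → false)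

placeBetween : ∀ {n} → Subset n → Subset n →
               (Fin n → Fin n → Bool) → (Fin n → Fin n → Bool)
placeBetween X Y P u v =
  P u v ∨ ((lookup X u ∧ lookup Y v) ∨ (lookup Y u ∧ lookup X v))

placeInside : ∀ {n} → Graph n → Subset n →
              (Fin n → Fin n → Bool) → (Fin n → Fin n → Bool)
placeInside G X P u v = P u v ∨ (lookup X u ∧ lookup X v ∧ adj G u v)

-- L ─ X∈ is the list L with the entry at which X∈ locates X deleted, so
-- Y∈ : Y ∈ (L ─ X∈) selects a live cable other than X.

data Move {n} (G : Graph n) : Config n → Config n → Set where

  birth  : ∀ {B L P} (S : Subset n) →
           Nonempty S → S ⊆ ∁ B →
           Move G (config B L P) (config (B ∪ S) (S ∷ L) P)

  fold   : ∀ {B L P X Y} (X∈ : X List.∈ L) (Y∈ : Y List.∈ (L ─ X∈)) →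
           Move G (config B L P) (config B ((X ∪ Y) ∷ ((L ─ X∈) ─ Y∈)) P)

  block  : ∀ {B L P X Y} (X∈ : X List.∈ L) (Y∈ : Y List.∈ (L ─ X∈)) →
           (∀ x y → x ∈ X → y ∈ Y → adj G x y ≡ true) →
           (∃ λ x → ∃ λ y → x ∈ X × y ∈ Y × P x y ≡ false) →
           Move G (config B L P) (config B L (placeBetween X Y P))

  clique : ∀ {B L P X} (X∈ : X List.∈ L) →
           (∀ x y → x ∈ X → y ∈ X → x ≢ y → adj G x y ≡ true) →
           (∃ λ x → ∃ λ y → x ∈ X × y ∈ X × x ≢ y × P x y ≡ false) →
           Move G (config B L P) (config B L (placeInside G X P))

  close  : ∀ {B L P X} (X∈ : X List.∈ L) →
           (∀ x v → x ∈ X → adj G x v ≡ true → P x v ≡ true) →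
           Move G (config B L P) (config B (L ─ X∈) P)

-- Truncated subtraction is exact here: a cable to be folded or closed is live,
-- so ℓ ≥ 1.

cost : ∀ {n} {G : Graph n} {C D} → Move G C D → ℕ
cost {C = C} (birth _ _ _)   = 2 * length (live C) + 1
cost {C = C} (fold _ _)      = 2 * length (live C) ∸ 1
cost {C = C} (block _ _ _ _) = 2 * length (live C)
cost {C = C} (clique _ _ _)  = 2 * length (live C)
cost {C = C} (close _ _)     = 2 * length (live C) ∸ 1

Play : ∀ {n} → Graph n → Config n → Set
Play G = Star (Move G) initial

-- The empty play has width 0; it is relevant only to the empty graph, for
-- which it gives the value 0.

width : ∀ {n} {G : Graph n} {C D} → Star (Move G) C D → ℕ
width ε        = 0
width (m ◅ ms) = cost m ⊔ width ms

Constructed : ∀ {n} → Graph n → Config n → Set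
Constructed G C =
  (∀ v → v ∈ born C) ×
  (∀ u v → adj G u v ≡ true → placed C u v ≡ true) ×
  live C ≡ []

IsLsfw : ∀ {n} → Graph n → ℕ → Set
IsLsfw {n} G =
  IsMinimum (λ w → Σ (Config n) λ C → Constructed G C ×
                   Σ (Play G C) λ p → width p ≡ w)

{-# OPTIONS --safe #-}

-- Lower bound: order the vertices by birth.  Two vertices of a live cable are
-- treated alike by all later moves, so they have the same neighbours among the
-- pairs still to be placed, and a closed vertex has no unborn neighbour.  Hence
-- the cutrank of a prefix is at most the number ℓ of live cables, and the moves
-- of cost below 2ℓ are the folds and closes, which leave ℓ ∸ 1 cables without
-- changing the cut.
--
-- Upper bound: along an order of width r, keep as live cables the classes of
-- vertices with equal, nonzero rows towards the unborn vertices.  A row space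
-- of dimension r over 𝔽₂ has at most 2 ^ r ∸ 1 nonzero vectors, so there are
-- at most 2 ^ r live cables after the birth of the next vertex.
--
-- Both minima exist constructively because orders and plays can be searched:
-- every move decreases a natural number measure.

module Submission where

open import Defs
open import Algebra.Bundles using (CommutativeRing)
open import Data.Bool using (Bool; true; false; not; _∧_; _∨_; _xor_)
import Data.Bool as Bool
open import Data.Bool.Properties
  using (xor-∧-commutativeRing; ¬-not; xor-same; xor-identityʳ; ∧-comm; ∨-comm)
open import Data.Fin as Fin using (Fin; zero; suc; toℕ; fromℕ<; combine; remQuot)
open import Data.Fin.Permutation as Perm
  using (Permutation; Permutation′; permutation; _⟨$⟩ˡ_; _⟨$⟩ʳ_; ↔⇒≡)
open import Data.Fin.Properties as Fin
  using (any?; all?; injective⇒≤; combine-injective; remQuot-combine;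
         toℕ<n; toℕ-fromℕ<; toℕ-injective)
open import Data.Fin.Subset as Subset
  using (Subset; _∈_; _∉_; _⊆_; _∪_; ∁; ∣_∣; Nonempty; ⁅_⁆)
open import Data.Fin.Subset.Induction using (⊃-wellFounded; Acc; acc)
open import Data.Fin.Subset.Properties
open import Data.List using (List; []; _∷_; length) renaming (lookup to lookupₗ)
import Data.List.Membership.Propositional as List
open import Data.List.Membership.Propositional.Properties using (∈-lookup)
open import Data.List.Properties using (length-removeAt′)
open import Data.List.Relation.Unary.All as All using (All; []; _∷_)
open import Data.List.Relation.Unary.All.Properties using (¬Any⇒All¬)
open import Data.List.Relation.Unary.AllPairs using (AllPairs; []; _∷_)
open import Data.List.Relation.Unary.Any as Any using (Any; here; there; index; _─_)
open import Data.Nat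
  using (ℕ; zero; suc; _+_; _*_; _∸_; _^_; _≤_; _<_; _<?_; z≤n; s≤s; s≤s⁻¹; ⌊_/2⌋; ⌈_/2⌉)
import Data.Nat.Properties as ℕ
open import Data.Product using (Σ; ∃; ∃₂; _×_; _,_; proj₁; proj₂; uncurry)
open import Data.Sum using (_⊎_; inj₁; inj₂)
open import Data.Vec using ([]; _∷_; lookup; tabulate; zipWith; here; there)
open import Data.Vec.Properties
  using ([]=⇒lookup; lookup⇒[]=; lookup∘tabulate; lookup-zipWith; lookup-replicate)
open import Function using (_∘_; id; case_of_)
open import Relation.Binary.Construct.Closure.ReflexiveTransitive using (Star; ε; _◅_)
open import Relation.Binary.PropositionalEquality
open import Relation.Nullary
  using (Dec; yes; no; ¬_; contradiction; ¬?; _×-dec_; _→-dec_; _⊎-dec_; does)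
open import Relation.Nullary.Decidable using (map′; decidable-stable; dec-true)

open import Algebra.Properties.CommutativeMonoid.Sum
  (CommutativeRing.+-commutativeMonoid xor-∧-commutativeRing)
  using (sum-cong-≗; sum-replicate-zero; ∑-distrib-+) renaming (sum to ⊕-sum)

private
  variable
    m n : ℕ
    A B : Set

-- Rank over 𝔽₂

∉⇒lookup≡false : ∀ {p : Subset n} {i} → i ∉ p → lookup p i ≡ false
∉⇒lookup≡false {p = p} {i} i∉p = ¬-not (i∉p ∘ lookup⇒[]= i p)

lookup≡false⇒∉ : ∀ {p : Subset n} {i} → lookup p i ≡ false → i ∉ p
lookup≡false⇒∉ eq i∈p = case trans (sym ([]=⇒lookup i∈p)) eq of λ ()

∈-tabulate⁺ : ∀ {f : Fin n → Bool} {i} → f i ≡ true → i ∈ tabulate f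
∈-tabulate⁺ {f = f} {i} eq = lookup⇒[]= i _ (trans (lookup∘tabulate f i) eq)

∈-tabulate⁻ : ∀ {f : Fin n → Bool} {i} → i ∈ tabulate f → f i ≡ true
∈-tabulate⁻ {f = f} {i} i∈ = trans (sym (lookup∘tabulate f i)) ([]=⇒lookup i∈)

⊕-sum-false : ∀ {t : Fin n → Bool} → (∀ i → t i ≡ false) → ⊕-sum t ≡ false
⊕-sum-false {n} t≡false = trans (sum-cong-≗ t≡false) (sum-replicate-zero n)

⊕-sum-⁅⁆ : ∀ (x : Fin n) (t : Fin n → Bool) → ⊕-sum (λ i → lookup ⁅ x ⁆ i ∧ t i) ≡ t x
⊕-sum-⁅⁆ zero    t = trans
  (cong (t zero xor_) (⊕-sum-false λ i → cong (_∧ t (suc i)) (lookup-replicate i false)))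
  (xor-identityʳ (t zero))
⊕-sum-⁅⁆ (suc x) t = ⊕-sum-⁅⁆ x (t ∘ suc)

infixl 5 _△_

-- Coefficient vectors over 𝔽₂ are represented by subsets, with symmetric difference as addition;
-- this makes linear dependencies searchable.
_△_ : Subset n → Subset n → Subset n
_△_ = zipWith _xor_

∈-△⁻ : ∀ {p q : Subset n} {i} → i ∈ p △ q → i ∈ p ⊎ i ∈ q
∈-△⁻ {p = p} {q} {i} i∈ with i ∈? p | i ∈? q
... | yes i∈p | _       = inj₁ i∈p
... | no  _   | yes i∈q = inj₂ i∈q
... | no  i∉p | no  i∉q = contradiction i∈ (lookup≡false⇒∉
  (trans (lookup-zipWith _xor_ i p q) (cong₂ _xor_ (∉⇒lookup≡false i∉p) (∉⇒lookup≡false i∉q))))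

∈-△⁺ˡ : ∀ {p q : Subset n} {i} → i ∈ p → i ∉ q → i ∈ p △ q
∈-△⁺ˡ {p = p} {q} {i} i∈p i∉q = lookup⇒[]= i _
  (trans (lookup-zipWith _xor_ i p q) (cong₂ _xor_ ([]=⇒lookup i∈p) (∉⇒lookup≡false i∉q)))

∉-△ : ∀ {p q : Subset n} {i} → i ∈ p → i ∈ q → i ∉ p △ q
∉-△ {p = p} {q} {i} i∈p i∈q = lookup≡false⇒∉
  (trans (lookup-zipWith _xor_ i p q) (cong₂ _xor_ ([]=⇒lookup i∈p) ([]=⇒lookup i∈q)))

module _ (M : Fin n → Fin n → Bool) where

  combination : Subset n → Fin n → Bool
  combination c j = ⊕-sum (λ i → lookup c i ∧ M i j)

  combination-△ : ∀ c d j → combination (c △ d) j ≡ combination c j xor combination d j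
  combination-△ c d j = trans
    (sum-cong-≗ λ i → trans (cong (_∧ M i j) (lookup-zipWith _xor_ i c d))
                            (CommutativeRing.distribʳ xor-∧-commutativeRing (M i j) (lookup c i) (lookup d i)))
    (∑-distrib-+ (λ i → lookup c i ∧ M i j) (λ i → lookup d i ∧ M i j))

  combination-⁅⁆ : ∀ x j → combination ⁅ x ⁆ j ≡ M x j
  combination-⁅⁆ x j = ⊕-sum-⁅⁆ x (λ i → M i j)

  Vanishing : Subset n → Subset n → Set
  Vanishing Y c = ∀ j → j ∈ Y → combination c j ≡ false

  independent⇒nonvanishing : ∀ {R Y c} → IndependentRows M R Y →
                             c ⊆ R → Nonempty c → ¬ Vanishing Y c
  independent⇒nonvanishing {c = c} indep c⊆R (i , i∈c) vanish =
    lookup≡false⇒∉ (indep (lookup c) (λ i i∉R → ∉⇒lookup≡false (i∉R ∘ c⊆R)) vanish i) i∈c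

  -- A coefficient function that vanishes outside `R` is the indicator of a subset of `R`, so a
  -- finite search over subsets either finds a nontrivial dependency or proves independence.
  independent? : ∀ R Y → IndependentRows M R Y ⊎
                 Σ (Subset n) λ c → c ⊆ R × Nonempty c × Vanishing Y c
  independent? R Y with anySubset? (λ c → c ⊆? R ×-dec nonempty? c ×-dec
                          all? (λ j → (j ∈? Y) →-dec (combination c j Bool.≟ false)))
  ... | yes dependency  = inj₂ dependency
  ... | no ¬dependency = inj₁ λ c support vanish i → ¬-not λ ci →
    ¬dependency
      ( tabulate c
      , (λ {x} x∈ → decidable-stable (x ∈? R) λ x∉R →
           case trans (sym (∈-tabulate⁻ x∈)) (support x x∉R) of λ ())
      , (i , ∈-tabulate⁺ ci)
      , λ j j∈Y → trans (sum-cong-≗ λ k → cong (_∧ M k j) (lookup∘tabulate c k)) (vanish j j∈Y))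

  independentRows? : ∀ R Y → Dec (IndependentRows M R Y)
  independentRows? R Y with independent? R Y
  ... | inj₁ indep = yes indep
  ... | inj₂ (c , c⊆R , c≢∅ , vanish) = no λ indep → independent⇒nonvanishing indep c⊆R c≢∅ vanish

  RankAtMost : ℕ → Subset n → Subset n → Set
  RankAtMost k X Y = ∀ R → R ⊆ X → IndependentRows M R Y → ∣ R ∣ ≤ k

  module _ {X Y R : Subset n} (R⊆X : R ⊆ X) (indep : IndependentRows M R Y)
           (maximal : RankAtMost ∣ R ∣ X Y) where

    -- Exchange argument: for `x ∉ R` the set `R ∪ ⁅ x ⁆` cannot be independent, since `R` has
    -- maximal size. A dependency of it must contain `x`, as `R` itself is independent, and can be
    -- solved for row `x`.
    spanned : ∀ {x} → x ∈ X →
              Σ (Subset n) λ c → c ⊆ R × (∀ j → j ∈ Y → M x j ≡ combination c j)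
    spanned {x} x∈X with x ∈? R
    ... | yes x∈R = ⁅ x ⁆
                  , (λ i∈ → subst (_∈ R) (sym (x∈⁅y⁆⇒x≡y x i∈)) x∈R)
                  , λ j _ → sym (combination-⁅⁆ x j)
    ... | no x∉R with independent? (R ∪ ⁅ x ⁆) Y
    ...   | inj₁ indep′ = contradiction
              (maximal (R ∪ ⁅ x ⁆)
                (λ i∈ → case x∈p∪q⁻ R ⁅ x ⁆ i∈ of λ where
                   (inj₁ i∈R) → R⊆X i∈R
                   (inj₂ i∈x) → subst (_∈ X) (sym (x∈⁅y⁆⇒x≡y x i∈x)) x∈X)
                indep′)
              (ℕ.<⇒≱ (p⊂q⇒∣p∣<∣q∣ (p⊆p∪q ⁅ x ⁆ , x , q⊆p∪q R ⁅ x ⁆ (x∈⁅x⁆ x) , x∉R)))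
    ...   | inj₂ (d , d⊆ , d≢∅ , vanish) with x ∈? d
    ...     | no x∉d = contradiction vanish (independent⇒nonvanishing indep
                (λ i∈d → case x∈p∪q⁻ R ⁅ x ⁆ (d⊆ i∈d) of λ where
                   (inj₁ i∈R) → i∈R
                   (inj₂ i∈x) → contradiction (subst (_∈ d) (x∈⁅y⁆⇒x≡y x i∈x) i∈d) x∉d)
                d≢∅)
    -- Signs do not matter over 𝔽₂: row `x` is the sum of the other rows of the dependency, and
    -- `d △ ⁅ x ⁆` is `d` without `x`.
    ...     | yes x∈d = d △ ⁅ x ⁆ , sub , λ j j∈Y → sym (trans (combination-△ d ⁅ x ⁆ j)
                (cong₂ _xor_ (vanish j j∈Y) (combination-⁅⁆ x j)))
      where
      sub : d △ ⁅ x ⁆ ⊆ R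
      sub {i} i∈ with ∈-△⁻ {p = d} i∈
      ... | inj₂ i∈x = contradiction i∈
              (∉-△ (subst (_∈ d) (sym (x∈⁅y⁆⇒x≡y x i∈x)) x∈d) i∈x)
      ... | inj₁ i∈d with x∈p∪q⁻ R ⁅ x ⁆ (d⊆ i∈d)
      ...   | inj₁ i∈R = i∈R
      ...   | inj₂ i∈x = contradiction i∈ (∉-△ i∈d i∈x)

-- Coding and enumerating subsets

bit : Bool → Fin 2
bit false = zero
bit true  = suc zero

bit-injective : ∀ {a b} → bit a ≡ bit b → a ≡ b
bit-injective {false} {false} _ = refl
bit-injective {true}  {true}  _ = refl

-- Only the bits of `c` at elements of `R` are recorded. This brings the range down to `2 ^ ∣ R ∣`
-- and is why injectivity is restricted to subsets of `R`.
encode : (R : Subset n) → Subset n → Fin (2 ^ ∣ R ∣)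
encode []          c       = zero
encode (false ∷ R) (_ ∷ c) = encode R c
encode (true  ∷ R) (b ∷ c) = combine {2} (bit b) (encode R c)

encode-injective : ∀ (R : Subset n) {c d} → c ⊆ R → d ⊆ R → encode R c ≡ encode R d → c ≡ d
encode-injective []          {[]} {[]} _ _ _ = refl
encode-injective (false ∷ R) {true ∷ c}  {_}         c⊆ d⊆ eq with () ← c⊆ here
encode-injective (false ∷ R) {false ∷ c} {true ∷ d}  c⊆ d⊆ eq with () ← d⊆ here
encode-injective (false ∷ R) {false ∷ c} {false ∷ d} c⊆ d⊆ eq =
  cong (false ∷_) (encode-injective R (drop-∷-⊆ c⊆) (drop-∷-⊆ d⊆) eq)
encode-injective (true ∷ R) {a ∷ c} {b ∷ d} c⊆ d⊆ eq
  with combine-injective (bit a) (encode R c) (bit b) (encode R d) eq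
... | a≡b , eq′ = cong₂ _∷_ (bit-injective a≡b)
  (encode-injective R (drop-there ∘ c⊆ ∘ there) (drop-there ∘ d⊆ ∘ there) eq′)

element : (R : Subset n) → Fin ∣ R ∣ → Fin n
element (false ∷ R) i       = suc (element R i)
element (true  ∷ R) zero    = zero
element (true  ∷ R) (suc i) = suc (element R i)

element-∈ : ∀ (R : Subset n) i → element R i ∈ R
element-∈ (false ∷ R) i       = there (element-∈ R i)
element-∈ (true  ∷ R) zero    = here
element-∈ (true  ∷ R) (suc i) = there (element-∈ R i)

element-injective : ∀ (R : Subset n) {i j} → element R i ≡ element R j → i ≡ j
element-injective (false ∷ R) eq = element-injective R (Fin.suc-injective eq)
element-injective (true ∷ R) {zero}  {zero}  eq = refl
element-injective (true ∷ R) {suc i} {suc j} eq =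
  cong suc (element-injective R (Fin.suc-injective eq))

module _ (M : Fin n → Fin n → Bool) {Y : Subset n} where

  -- A zero row or two equal rows would be a dependency with one or two terms, so the labels are
  -- injective on an independent set. Labels are asked of nonzero rows only, because closed vertices
  -- lie in no live cable.
  rank≤classes : ∀ {R} → IndependentRows M R Y →
    (class : ∀ {x} → x ∈ R → ¬ (∀ j → j ∈ Y → M x j ≡ false) → Fin m) →
    (∀ {x y} (x∈ : x ∈ R) (y∈ : y ∈ R) p q → class x∈ p ≡ class y∈ q →
       ∀ j → j ∈ Y → M x j ≡ M y j) →
    ∣ R ∣ ≤ m
  rank≤classes {R = R} indep class twins = injective⇒≤ {f = f} f-injective
    where
    nonzero : ∀ {x} → x ∈ R → ¬ (∀ j → j ∈ Y → M x j ≡ false)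
    nonzero {x} x∈R zero-row = independent⇒nonvanishing M {c = ⁅ x ⁆} indep
      (λ i∈ → subst (_∈ R) (sym (x∈⁅y⁆⇒x≡y x i∈)) x∈R) (x , x∈⁅x⁆ x)
      λ j j∈Y → trans (combination-⁅⁆ M x j) (zero-row j j∈Y)
    distinct : ∀ {x y} → x ∈ R → y ∈ R → x ≢ y → ¬ (∀ j → j ∈ Y → M x j ≡ M y j)
    distinct {x} {y} x∈R y∈R x≢y same = independent⇒nonvanishing M {c = ⁅ x ⁆ △ ⁅ y ⁆} indep
      (λ i∈ → case ∈-△⁻ {p = ⁅ x ⁆} i∈ of λ where
         (inj₁ i∈x) → subst (_∈ R) (sym (x∈⁅y⁆⇒x≡y x i∈x)) x∈R
         (inj₂ i∈y) → subst (_∈ R) (sym (x∈⁅y⁆⇒x≡y y i∈y)) y∈R)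
      (x , ∈-△⁺ˡ (x∈⁅x⁆ x) (x≢y⇒x∉⁅y⁆ x≢y))
      λ j j∈Y → trans (combination-△ M ⁅ x ⁆ ⁅ y ⁆ j)
        (trans (cong₂ _xor_ (trans (combination-⁅⁆ M x j) (same j j∈Y)) (combination-⁅⁆ M y j))
               (xor-same (M y j)))
    f : Fin ∣ R ∣ → Fin _
    f i = class (element-∈ R i) (nonzero (element-∈ R i))
    f-injective : ∀ {i j} → f i ≡ f j → i ≡ j
    f-injective {i} {j} eq = decidable-stable (i Fin.≟ j) λ i≢j →
      distinct (element-∈ R i) (element-∈ R j) (i≢j ∘ element-injective R)
        (twins _ _ _ _ eq)

  -- Over 𝔽₂ a spanning set R of the rows yields at most 2 ^ ∣ R ∣ distinct rows;
  -- the extra one accounts for the zero row.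
  distinct-nonzero-rows : ∀ {X R} → R ⊆ X → IndependentRows M R Y → RankAtMost M ∣ R ∣ X Y →
    (f : Fin m → Fin n) → (∀ i → f i ∈ X) →
    (∀ i → ¬ (∀ y → y ∈ Y → M (f i) y ≡ false)) →
    (∀ i j → (∀ y → y ∈ Y → M (f i) y ≡ M (f j) y) → i ≡ j) →
    suc m ≤ 2 ^ ∣ R ∣
  distinct-nonzero-rows {m = m} {X} {R} R⊆X indep maximal f f∈X nonzero distinct =
    injective⇒≤ {f = g} g-injective
    where
    coefficients : ∀ i → Σ (Subset n) λ c → c ⊆ R × (∀ y → y ∈ Y → M (f i) y ≡ combination M c y)
    coefficients i = spanned M R⊆X indep maximal (f∈X i)
    g : Fin (suc m) → Fin (2 ^ ∣ R ∣)
    g zero    = encode R Subset.⊥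
    g (suc i) = encode R (proj₁ (coefficients i))
    combination-⊥ : ∀ y → combination M Subset.⊥ y ≡ false
    combination-⊥ y = ⊕-sum-false λ i → cong (_∧ M i y) (lookup-replicate i false)
    coefficient≢⊥ : ∀ i → encode R Subset.⊥ ≢ encode R (proj₁ (coefficients i))
    coefficient≢⊥ i eq with coefficients i
    ... | c , c⊆R , row = nonzero i λ y y∈Y → trans (row y y∈Y)
      (trans (cong (λ c → combination M c y) (sym (encode-injective R (⊆-min R) c⊆R eq))) (combination-⊥ y))
    g-injective : ∀ {i j} → g i ≡ g j → i ≡ j
    g-injective {zero}  {zero}  eq = refl
    g-injective {zero}  {suc j} eq = contradiction eq (coefficient≢⊥ j)
    g-injective {suc i} {zero}  eq = contradiction (sym eq) (coefficient≢⊥ i)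
    g-injective {suc i} {suc j} eq with coefficients i | coefficients j
    ... | c , c⊆R , rowᵢ | d , d⊆R , rowⱼ = cong suc (distinct i j λ y y∈Y →
      trans (rowᵢ y y∈Y) (trans (cong (λ c → combination M c y) (encode-injective R c⊆R d⊆R eq))
        (sym (rowⱼ y y∈Y))))

-- Vertex orders and linear rank-width

greatest : ∀ {P : ℕ → Set} → (∀ k → Dec (P k)) → ∀ N → (∀ k → P k → k ≤ N) →
           ∃ P → ∃ (IsMaximum P)
greatest P? zero    bound (k , p) with z≤n ← bound k p = 0 , p , bound
greatest P? (suc N) bound (k , p) with P? (suc N)
... | yes q = suc N , q , bound
... | no ¬q = greatest P? N
  (λ j pj → s≤s⁻¹ (ℕ.≤∧≢⇒< (bound j pj) λ { refl → ¬q pj })) (k , p)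

least : ∀ {P : ℕ → Set} → (∀ k → Dec (P k)) → ∀ k → P k → ∃ (IsMinimum P)
least P? k p with P? 0
least P? k       p | yes q = 0 , q , λ _ _ → z≤n
least P? zero    p | no ¬q = contradiction p ¬q
least P? (suc k) p | no ¬q with least (P? ∘ suc) k p
... | m , q , min = suc m , q , λ where
  zero    q₀ → contradiction q₀ ¬q
  (suc j) qj → s≤s (min j qj)

does-true⇒ : ∀ {A : Set} (a? : Dec A) → does a? ≡ true → A
does-true⇒ (yes a) _ = a

IsMaximum-unique : ∀ {P m m′} → IsMaximum P m → IsMaximum P m′ → m ≡ m′
IsMaximum-unique (p , max) (p′ , max′) = ℕ.≤-antisym (max′ _ p) (max _ p′)

∉-∪⁅⁆ : ∀ {X : Subset n} {u v} → v ∉ X → v ≢ u → v ∉ X ∪ ⁅ u ⁆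
∉-∪⁅⁆ {X = X} {u} v∉X v≢u v∈ with x∈p∪q⁻ X ⁅ u ⁆ v∈
... | inj₁ v∈X = v∉X v∈X
... | inj₂ v∈u = v≢u (x∈⁅y⁆⇒x≡y u v∈u)

∈-∪⁅⁆ : ∀ (X : Subset n) u → u ∈ X ∪ ⁅ u ⁆
∈-∪⁅⁆ X u = q⊆p∪q X ⁅ u ⁆ (x∈⁅x⁆ u)

∪⁅⁆-⊆ : ∀ {X T : Subset n} {v} → X ⊆ T → v ∈ T → X ∪ ⁅ v ⁆ ⊆ T
∪⁅⁆-⊆ {X = X} {T} {v} X⊆T v∈T i∈ with x∈p∪q⁻ X ⁅ v ⁆ i∈
... | inj₁ i∈X = X⊆T i∈X
... | inj₂ i∈v = subst (_∈ T) (sym (x∈⁅y⁆⇒x≡y v i∈v)) v∈T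

⊂-∪⁅⁆ : ∀ {X : Subset n} {v} → v ∉ X → X Subset.⊂ X ∪ ⁅ v ⁆
⊂-∪⁅⁆ {X = X} {v} v∉X = p⊆p∪q ⁅ v ⁆ , v , ∈-∪⁅⁆ X v , v∉X

∈-prefix⁺ : ∀ (π : Permutation′ n) {v i} → toℕ (π ⟨$⟩ˡ v) < i → v ∈ prefix π i
∈-prefix⁺ π {v} {i} p = ∈-tabulate⁺ (dec-true (toℕ (π ⟨$⟩ˡ v) <? i) p)

∈-prefix⁻ : ∀ (π : Permutation′ n) {v i} → v ∈ prefix π i → toℕ (π ⟨$⟩ˡ v) < i
∈-prefix⁻ π {v} {i} v∈ = does-true⇒ (toℕ (π ⟨$⟩ˡ v) <? i) (∈-tabulate⁻ v∈)

-- An enumeration of the vertices is indexed by its own length, which is not `n` by definition. The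
-- bijection forces the two numbers to agree, and the permutation can be retyped.
square : ∀ {k} (π : Permutation k n) →
         Σ (Permutation′ n) λ π′ → ∀ v → toℕ (π′ ⟨$⟩ˡ v) ≡ toℕ (π ⟨$⟩ˡ v)
square π with refl ← ↔⇒≡ π = π , λ _ → refl

-- An enumeration of the vertices outside X, such that every nonempty initial
-- segment together with X satisfies Q.
data Extension (Q : Subset n → Set) (X : Subset n) : Set where
  done : (∀ v → v ∈ X) → Extension Q X
  add  : ∀ v → v ∉ X → Q (X ∪ ⁅ v ⁆) → Extension Q (X ∪ ⁅ v ⁆) → Extension Q X

map-extension : ∀ {Q Q′ : Subset n → Set} → (∀ {X} → Q X → Q′ X) →
                ∀ {X} → Extension Q X → Extension Q′ X
map-extension f (done full)     = done full
map-extension f (add v v∉X q e) = add v v∉X (f q) (map-extension f e)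

module _ {Q : Subset n → Set} where

  extension? : (∀ X → Dec (Q X)) → ∀ X → Dec (Extension Q X)
  extension? Q? X = go X (⊃-wellFounded X)
    where
    go : ∀ X → Acc Subset._⊃_ X → Dec (Extension Q X)
    go X (acc rec) with all? (_∈? X)
    ... | yes full = yes (done full)
    ... | no ¬full = map′
        (λ { (v , v∉X , q , e) → add v v∉X q e })
        (λ { (done full) → contradiction full ¬full ; (add v v∉X q e) → v , v∉X , q , e })
        (any? step?)
      where
      -- Membership is decided first: the recursive call is well-founded only for a vertex that
      -- enlarges `X`.
      step? : ∀ v → Dec (v ∉ X × Q (X ∪ ⁅ v ⁆) × Extension Q (X ∪ ⁅ v ⁆))
      step? v with v ∈? X
      ... | yes v∈X = no λ { (v∉X , _) → v∉X v∈X }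
      ... | no v∉X  = map′ (v∉X ,_) proj₂ (Q? (X ∪ ⁅ v ⁆) ×-dec go (X ∪ ⁅ v ⁆) (rec (⊂-∪⁅⁆ v∉X)))

  -- The vertices of `T` outside `X` can be added in any order, since every intermediate set
  -- satisfies `Q`. This handles a birth of several vertices at once.
  extend : ∀ {X T} → X ⊆ T → (∀ Z → X ⊆ Z → Z ⊆ T → Q Z) → Extension Q T → Extension Q X
  extend {X} {T} X⊆T qs e = go X (⊃-wellFounded X) X⊆T qs
    where
    go : ∀ X → Acc Subset._⊃_ X → X ⊆ T → (∀ Z → X ⊆ Z → Z ⊆ T → Q Z) → Extension Q X
    go X (acc rec) X⊆T qs with any? (λ v → v ∈? T ×-dec ¬? (v ∈? X))
    ... | yes (v , v∈T , v∉X) = add v v∉X (qs _ (p⊆p∪q ⁅ v ⁆) X∪v⊆T)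
            (go (X ∪ ⁅ v ⁆) (rec (⊂-∪⁅⁆ v∉X)) X∪v⊆T λ Z X∪v⊆Z → qs Z (X∪v⊆Z ∘ p⊆p∪q ⁅ v ⁆))
      where X∪v⊆T = ∪⁅⁆-⊆ X⊆T v∈T
    ... | no none = subst (Extension Q)
            (⊆-antisym (λ {v} v∈T → decidable-stable (v ∈? X) λ v∉X → none (v , v∈T , v∉X)) X⊆T) e

  -- Past the end of the enumeration the stage stays the full vertex set, in accordance with
  -- prefixes longer than the order.
  stage : ∀ {X} → Extension Q X → ℕ → Subset n
  stage {X} _             zero    = X
  stage {X} (done _)      (suc i) = X
  stage     (add _ _ _ e) (suc i) = stage e i

  size : ∀ {X} → Extension Q X → ℕ
  size (done _)      = 0
  size (add _ _ _ e) = suc (size e)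

  -- The value on the vertices of X is junk.
  position : ∀ {X} → Extension Q X → Fin n → ℕ
  position (done _)      v = 0
  position (add u _ _ e) v with v Fin.≟ u
  ... | yes _ = 0
  ... | no  _ = suc (position e v)

  vertex : ∀ {X} (e : Extension Q X) → Fin (size e) → Fin n
  vertex (add u _ _ e) zero    = u
  vertex (add u _ _ e) (suc i) = vertex e i

  stage-Q : ∀ {X} → Q X → (e : Extension Q X) → ∀ i → Q (stage e i)
  stage-Q q _              zero    = q
  stage-Q q (done _)       (suc i) = q
  stage-Q q (add _ _ q′ e) (suc i) = stage-Q q′ e i

  ⊆-stage : ∀ {X} (e : Extension Q X) i → X ⊆ stage e i
  ⊆-stage _             zero    = id
  ⊆-stage (done _)      (suc i) = id
  ⊆-stage (add v _ _ e) (suc i) = ⊆-stage e i ∘ p⊆p∪q ⁅ v ⁆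

  position<size : ∀ {X} (e : Extension Q X) {v} → v ∉ X → position e v < size e
  position<size (done full)   {v} v∉X = contradiction (full v) v∉X
  position<size (add u _ _ e) {v} v∉X with v Fin.≟ u
  ... | yes _   = s≤s z≤n
  ... | no v≢u = s≤s (position<size e (∉-∪⁅⁆ v∉X v≢u))

  vertex-∉ : ∀ {X} (e : Extension Q X) i → vertex e i ∉ X
  vertex-∉ (add u u∉X _ e) zero    = u∉X
  vertex-∉ (add u u∉X _ e) (suc i) = vertex-∉ e i ∘ p⊆p∪q ⁅ u ⁆

  position-vertex : ∀ {X} (e : Extension Q X) i → position e (vertex e i) ≡ toℕ i
  position-vertex (add u u∉X _ e) zero with u Fin.≟ u
  ... | yes _  = refl
  ... | no u≢u = contradiction refl u≢u
  position-vertex {X} (add u u∉X _ e) (suc i) with vertex e i Fin.≟ u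
  ... | yes eq = contradiction (subst (_∈ X ∪ ⁅ u ⁆) (sym eq) (∈-∪⁅⁆ X u)) (vertex-∉ e i)
  ... | no  _  = cong suc (position-vertex e i)

  vertex-position : ∀ {X} (e : Extension Q X) {v} → v ∉ X → .(p : position e v < size e) →
                    vertex e (fromℕ< p) ≡ v
  vertex-position (done full)   {v} v∉X p = contradiction (full v) v∉X
  vertex-position (add u _ _ e) {v} v∉X p with v Fin.≟ u
  ... | yes v≡u = sym v≡u
  ... | no  v≢u = vertex-position e (∉-∪⁅⁆ v∉X v≢u) (s≤s⁻¹ p)

  ∈-stage⁺ : ∀ {X} (e : Extension Q X) {v i} → v ∉ X → position e v < i → v ∈ stage e i
  ∈-stage⁺ (done full)   {v} {suc i} v∉X p = full v
  ∈-stage⁺ {X} (add u _ _ e) {v} {suc i} v∉X p with v Fin.≟ u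
  ... | yes refl = ⊆-stage e i (∈-∪⁅⁆ X v)
  ... | no  v≢u  = ∈-stage⁺ e (∉-∪⁅⁆ v∉X v≢u) (s≤s⁻¹ p)

  ∈-stage⁻ : ∀ {X} (e : Extension Q X) {v i} → v ∉ X → v ∈ stage e i → position e v < i
  ∈-stage⁻ e             {i = zero}      v∉X v∈ = contradiction v∈ v∉X
  ∈-stage⁻ (done full)   {v} {suc i} v∉X v∈ = s≤s z≤n
  ∈-stage⁻ (add u _ _ e) {v} {suc i} v∉X v∈ with v Fin.≟ u
  ... | yes _  = s≤s z≤n
  ... | no v≢u = s≤s (∈-stage⁻ e (∉-∪⁅⁆ v∉X v≢u) v∈)

  -- A vertex lies in stage `i` exactly when its position is below `i`, so the stages are the
  -- prefixes of the resulting order. The separate assumption on the empty set covers the prefix of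
  -- length 0.
  extension⇒order : Q Subset.⊥ → Extension Q Subset.⊥ →
                    Σ (Permutation′ n) λ π → ∀ i → Q (prefix π i)
  extension⇒order q e = π′ , λ i → subst Q
      (⊆-antisym
        (λ {v} v∈ → ∈-prefix⁺ π′ (subst (_< i) (sym (position≡ v)) (∈-stage⁻ e ∉⊥ v∈)))
        (λ {v} v∈ → ∈-stage⁺ e ∉⊥ (subst (_< i) (position≡ v) (∈-prefix⁻ π′ v∈))))
      (stage-Q q e i)
    where
    place : Fin n → Fin (size e)
    place v = fromℕ< (position<size e {v} ∉⊥)
    π : Permutation (size e) n
    π = permutation (vertex e) place
      (λ v → vertex-position e ∉⊥ (position<size e ∉⊥))
      (λ i → toℕ-injective (trans (toℕ-fromℕ< _) (position-vertex e i)))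
    π′ : Permutation′ n
    π′ = proj₁ (square π)
    position≡ : ∀ v → toℕ (π′ ⟨$⟩ˡ v) ≡ position e v
    position≡ v = trans (proj₂ (square π) v) (toℕ-fromℕ< _)

  order⇒extension : (π : Permutation′ n) → (∀ i → Q (prefix π (toℕ {suc n} i))) → Extension Q Subset.⊥
  order⇒extension π q = subst (Extension Q)
      (⊆-antisym (λ v∈ → case ∈-prefix⁻ π {i = 0} v∈ of λ ()) (⊆-min _)) (go n 0 (ℕ.+-identityʳ n))
    where
    -- `d` is the number of positions still to be enumerated.
    go : ∀ d i → d + i ≡ n → Extension Q (prefix π i)
    go zero    i refl = done λ v → ∈-prefix⁺ π (toℕ<n _)
    go (suc d) i eq   = add v v∉ (subst Q prefix≡ q′) (subst (Extension Q) prefix≡ rest)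
      where
      i<n : i < n
      i<n = subst (i <_) eq (s≤s (ℕ.m≤n+m i d))
      -- The vertex at the 0-based position `i`, by which the prefix of length `suc i` exceeds that
      -- of length `i`.
      v : Fin n
      v = π ⟨$⟩ʳ fromℕ< i<n
      place≡ : toℕ (π ⟨$⟩ˡ v) ≡ i
      place≡ = trans (cong toℕ (Perm.inverseˡ π)) (toℕ-fromℕ< i<n)
      v∉ : v ∉ prefix π i
      v∉ v∈ = ℕ.<-irrefl place≡ (∈-prefix⁻ π v∈)
      prefix≡ : prefix π (suc i) ≡ prefix π i ∪ ⁅ v ⁆
      prefix≡ = ⊆-antisym ⊆₁ ⊆₂
        where
        ⊆₁ : prefix π (suc i) ⊆ prefix π i ∪ ⁅ v ⁆
        ⊆₁ {u} u∈ with ℕ.m≤n⇒m<n∨m≡n (s≤s⁻¹ (∈-prefix⁻ π u∈))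
        ... | inj₁ u<i = p⊆p∪q ⁅ v ⁆ (∈-prefix⁺ π u<i)
        ... | inj₂ u≡i = subst (_∈ prefix π i ∪ ⁅ v ⁆) v≡u (∈-∪⁅⁆ (prefix π i) v)
          where
          v≡u : v ≡ u
          v≡u = trans (cong (π ⟨$⟩ʳ_) (toℕ-injective (trans (toℕ-fromℕ< i<n) (sym u≡i)))) (Perm.inverseʳ π)
        ⊆₂ : prefix π i ∪ ⁅ v ⁆ ⊆ prefix π (suc i)
        ⊆₂ = ∪⁅⁆-⊆ (λ u∈ → ∈-prefix⁺ π (ℕ.m≤n⇒m≤1+n (∈-prefix⁻ π u∈)))
                   (∈-prefix⁺ π (s≤s (ℕ.≤-reflexive place≡)))
      q′ : Q (prefix π (suc i))
      q′ = subst (Q ∘ prefix π) (toℕ-fromℕ< (s≤s i<n)) (q (fromℕ< (s≤s i<n)))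
      rest : Extension Q (prefix π (suc i))
      rest = go d (suc i) (trans (ℕ.+-suc d i) eq)

-- Existence of rank and linear rank-width

rank : ∀ (M : Fin n → Fin n → Bool) X Y → ∃ (IsRank M X Y)
rank {n} M X Y = greatest
  (λ r → anySubset? λ R → R ⊆? X ×-dec independentRows? M R Y ×-dec ∣ R ∣ ℕ.≟ r)
  n (λ { _ (R , _ , _ , refl) → ∣p∣≤n R })
  (0 , Subset.⊥ , ⊆-min X , (λ c support _ i → support i ∉⊥) , ∣⊥∣≡0 n)

module _ (G : Graph n) where

  CutrankAtMost : ℕ → Subset n → Set
  CutrankAtMost k X = RankAtMost (adj G) k X (∁ X)

  cutrank≤ : ∀ {X r k} → IsCutrank G X r → CutrankAtMost k X → r ≤ k
  cutrank≤ ((R , R⊆X , indep , refl) , _) bound = bound R R⊆X indep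

  cutrankAtMost : ∀ {X r k} → IsCutrank G X r → r ≤ k → CutrankAtMost k X
  cutrankAtMost (_ , max) r≤k R R⊆X indep = ℕ.≤-trans (max _ (R , R⊆X , indep , refl)) r≤k

  cutrankAtMost? : ∀ k X → Dec (CutrankAtMost k X)
  cutrankAtMost? k X with rank (adj G) X (∁ X)
  ... | r , isRank = map′ (cutrankAtMost isRank) (cutrank≤ isRank) (r ℕ.≤? k)

  orderWidth : ∀ π → ∃ (IsOrderWidth G π)
  orderWidth π = greatest
    (λ r → any? λ i → case rank (adj G) (prefix π (toℕ i)) _ of λ where
      (r′ , isRank) → map′ (λ { refl → isRank }) (IsMaximum-unique isRank) (r′ ℕ.≟ r))
    n (λ { r (i , (R , _ , _ , refl) , _) → ∣p∣≤n R })
    (_ , zero , proj₂ (rank (adj G) (prefix π 0) _))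

  cutrankAtMost-⊥ : ∀ k → CutrankAtMost k Subset.⊥
  cutrankAtMost-⊥ k R R⊆⊥ _ = ℕ.≤-trans
    (ℕ.≤-trans (p⊆q⇒∣p∣≤∣q∣ R⊆⊥) (ℕ.≤-reflexive (∣⊥∣≡0 n))) z≤n

  -- The minimum is found among extensions, where it is decidable, and transferred to orders. The
  -- second characterization is kept because both bounds work with extensions rather than
  -- permutations.
  linearRankWidth : Σ ℕ λ r → IsLrw G r × IsMinimum (λ k → Extension (CutrankAtMost k) Subset.⊥) r
  linearRankWidth with least (λ k → extension? (cutrankAtMost? k) Subset.⊥)
                        -- The bound `n` guarantees that the search succeeds: no set of rows has
                        -- more than `n` elements, so any enumeration will do.
                        n (extend {T = Subset.⊤} ⊆⊤ (λ _ _ _ R _ _ → ∣p∣≤n R) (done λ _ → ∈⊤))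
  ... | r , e , min with extension⇒order (cutrankAtMost-⊥ r) e
  ...   | π , bound with orderWidth π
  ...     | w , isWidth = r , ((π , subst (IsOrderWidth G π) w≡r isWidth) , lower) , e , min
    where
    lower : ∀ k → Σ (Permutation′ n) (λ π → IsOrderWidth G π k) → r ≤ k
    lower k (π , _ , max) = min k (order⇒extension π λ i →
      case rank (adj G) (prefix π (toℕ i)) _ of λ where
        (r , isRank) → cutrankAtMost isRank (max r (i , isRank)))
    w≡r : w ≡ r
    w≡r = ℕ.≤-antisym
      (case proj₁ isWidth of λ { (i , isRank) → cutrank≤ isRank (bound (toℕ i)) })
      (lower w (π , isWidth))

-- From plays to orders

module _ {P : A → Set} where

  ∈-─⁻ : ∀ {xs : List A} (x∈ : Any P xs) {y} → y List.∈ (xs ─ x∈) → y List.∈ xs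
  ∈-─⁻ (here _)   y∈         = there y∈
  ∈-─⁻ (there x∈) (here eq)  = here eq
  ∈-─⁻ (there x∈) (there y∈) = there (∈-─⁻ x∈ y∈)

  All-─ : ∀ {Q : A → Set} {xs : List A} (x∈ : Any P xs) → All Q xs → All Q (xs ─ x∈)
  All-─ (here _)   (_ ∷ qs) = qs
  All-─ (there x∈) (q ∷ qs) = q ∷ All-─ x∈ qs

∈-─⁺ : ∀ {xs : List A} {x y} (x∈ : x List.∈ xs) → y List.∈ xs → y ≡ x ⊎ y List.∈ (xs ─ x∈)
∈-─⁺ (here refl) (here eq)  = inj₁ eq
∈-─⁺ (here refl) (there y∈) = inj₂ y∈
∈-─⁺ (there x∈)  (here eq)  = inj₂ (here eq)
∈-─⁺ (there x∈)  (there y∈) with ∈-─⁺ x∈ y∈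
... | inj₁ eq  = inj₁ eq
... | inj₂ y∈′ = inj₂ (there y∈′)

-- Symmetry is needed because the deleted entry may come after some of the entries it is compared
-- with.
AllPairs-─ : ∀ {R : A → A → Set} → (∀ {x y} → R x y → R y x) → ∀ {xs x} (x∈ : x List.∈ xs) →
             AllPairs R xs → All (R x) (xs ─ x∈) × AllPairs R (xs ─ x∈)
AllPairs-─ R-sym (here refl) (r ∷ rs) = r , rs
AllPairs-─ R-sym (there x∈)  (r ∷ rs) with AllPairs-─ R-sym x∈ rs
... | r′ , rs′ = R-sym (All.lookup r x∈) ∷ r′ , All-─ x∈ r ∷ rs′

index≡⇒common : ∀ {P Q : A → Set} {xs : List A} (p : Any P xs) (q : Any Q xs) → index p ≡ index q →
                ∃ λ x → x List.∈ xs × P x × Q x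
index≡⇒common (here p)  (here q)  _ = _ , here refl , p , q
index≡⇒common (there p) (there q) eq with index≡⇒common p q (Fin.suc-injective eq)
... | x , x∈ , px , qx = x , there x∈ , px , qx

∧-true⁻ : ∀ {a b} → a ∧ b ≡ true → a ≡ true × b ≡ true
∧-true⁻ {true} {true} _ = refl , refl

∨-true⁻ : ∀ {a b} → a ∨ b ≡ true → a ≡ true ⊎ b ≡ true
∨-true⁻ {true}  _  = inj₁ refl
∨-true⁻ {false} eq = inj₂ eq

∨-true⁺ˡ : ∀ {a} b → a ≡ true → a ∨ b ≡ true
∨-true⁺ˡ b refl = refl

placeBetween⁻ : ∀ {X Y : Subset n} P {u v} → placeBetween X Y P u v ≡ true →
                P u v ≡ true ⊎ (u ∈ X × v ∈ Y) ⊎ (u ∈ Y × v ∈ X)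
placeBetween⁻ {X = X} {Y} P {u} {v} eq with ∨-true⁻ {P u v} eq
... | inj₁ p = inj₁ p
... | inj₂ eq′ with ∨-true⁻ {lookup X u ∧ lookup Y v} eq′
...   | inj₁ q with ∧-true⁻ q
...     | a , b = inj₂ (inj₁ (lookup⇒[]= u X a , lookup⇒[]= v Y b))
placeBetween⁻ {X = X} {Y} P {u} {v} eq | inj₂ eq′ | inj₂ q with ∧-true⁻ q
...     | a , b = inj₂ (inj₂ (lookup⇒[]= u Y a , lookup⇒[]= v X b))

placeInside⁻ : ∀ {G : Graph n} {X : Subset n} P {u v} → placeInside G X P u v ≡ true →
               P u v ≡ true ⊎ (u ∈ X × v ∈ X × adj G u v ≡ true)
placeInside⁻ {G = G} {X} P {u} {v} eq with ∨-true⁻ {P u v} eq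
... | inj₁ p = inj₁ p
... | inj₂ q with ∧-true⁻ q
...   | a , bc with ∧-true⁻ bc
...     | b , c = inj₂ (lookup⇒[]= u X a , lookup⇒[]= v X b , c)

-- Invariants of plays and the lower bound

Disjoint : Subset n → Subset n → Set
Disjoint X Y = ∀ x → x ∈ X → x ∉ Y

Disjoint-sym : ∀ {X Y : Subset n} → Disjoint X Y → Disjoint Y X
Disjoint-sym X#Y y y∈Y y∈X = X#Y y y∈X y∈Y

Disjoint-∪ : ∀ {X Y Z : Subset n} → Disjoint X Z → Disjoint Y Z → Disjoint (X ∪ Y) Z
Disjoint-∪ {X = X} {Y} X#Z Y#Z x x∈ with x∈p∪q⁻ X Y x∈
... | inj₁ x∈X = X#Z x x∈X
... | inj₂ x∈Y = Y#Z x x∈Y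

disjoint⇒≡ : ∀ {L : List (Subset n)} → AllPairs Disjoint L → ∀ {X Y x} →
             X List.∈ L → Y List.∈ L → x ∈ X → x ∈ Y → X ≡ Y
disjoint⇒≡ disjoint X∈ Y∈ x∈X x∈Y with ∈-─⁺ X∈ Y∈
... | inj₁ Y≡X = sym Y≡X
... | inj₂ Y∈′ = contradiction x∈Y (All.lookup (proj₁ (AllPairs-─ Disjoint-sym X∈ disjoint)) Y∈′ _ x∈X)

module _ (G : Graph n) where

  -- The invariant of reachable configurations. Together, `closed` and `placedBorn` say that a
  -- vertex whose cable has been closed has no unborn neighbour.
  record Valid (C : Config n) : Set where
    field
      disjoint   : AllPairs Disjoint (live C)
      liveBorn   : ∀ {X} → X List.∈ live C → X ⊆ born C
      placedBorn : ∀ {u v} → placed C u v ≡ true → u ∈ born C × v ∈ born C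
      closed     : ∀ {x v} → x ∈ born C → (∀ {X} → X List.∈ live C → x ∉ X) →
                   adj G x v ≡ true → placed C x v ≡ true

  open Valid

  initial-valid : Valid initial
  initial-valid = record
    { disjoint = [] ; liveBorn = λ () ; placedBorn = λ () ; closed = λ x∈⊥ → contradiction x∈⊥ ∉⊥ }

  step-valid : ∀ {C D} → Move G C D → Valid C → Valid D
  step-valid (birth {B} {L} {P} S S≢∅ S⊆∁B) val = record
    { disjoint = All.tabulate (λ X∈ x x∈S x∈X → x∈∁p⇒x∉p (S⊆∁B x∈S) (liveBorn val X∈ x∈X)) ∷ disjoint val
    ; liveBorn = λ where
        (here refl) → q⊆p∪q B S
        (there X∈)  → p⊆p∪q S ∘ liveBorn val X∈
    ; placedBorn = λ p → case placedBorn val p of λ where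
        (u∈B , v∈B) → p⊆p∪q S u∈B , p⊆p∪q S v∈B
    ; closed = λ x∈B∪S notLive → case x∈p∪q⁻ B S x∈B∪S of λ where
        (inj₁ x∈B) → closed val x∈B (notLive ∘ there)
        (inj₂ x∈S) → contradiction x∈S (notLive (here refl)) }
  step-valid (fold {X = X} {Y} X∈ Y∈) val
    with X# , rest ← AllPairs-─ Disjoint-sym X∈ (disjoint val)
    with Y# , rest′ ← AllPairs-─ Disjoint-sym Y∈ rest = record
    { disjoint = All.tabulate (λ Z∈ → Disjoint-∪ (All.lookup (All-─ Y∈ X#) Z∈) (All.lookup Y# Z∈)) ∷ rest′
    ; liveBorn = λ where
        (here refl) x∈ → case x∈p∪q⁻ X Y x∈ of λ where
          (inj₁ x∈X) → liveBorn val X∈ x∈X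
          (inj₂ x∈Y) → liveBorn val (∈-─⁻ X∈ Y∈) x∈Y
        (there Z∈) → liveBorn val (∈-─⁻ X∈ (∈-─⁻ Y∈ Z∈))
    ; placedBorn = placedBorn val
    ; closed = λ x∈B notLive → closed val x∈B λ Z∈ x∈Z → case ∈-─⁺ X∈ Z∈ of λ where
        (inj₁ refl) → notLive (here refl) (p⊆p∪q Y x∈Z)
        (inj₂ Z∈′)  → case ∈-─⁺ Y∈ Z∈′ of λ where
          (inj₁ refl) → notLive (here refl) (q⊆p∪q X Y x∈Z)
          (inj₂ Z∈″)  → notLive (there Z∈″) x∈Z }
  step-valid (block {B} {L} {P} {X} {Y} X∈ Y∈ _ _) val = record
    { disjoint = disjoint val
    ; liveBorn = liveBorn val
    ; placedBorn = λ p → case placeBetween⁻ {X = X} {Y} P p of λ where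
        (inj₁ q)                   → placedBorn val q
        (inj₂ (inj₁ (u∈X , v∈Y))) → liveBorn val X∈ u∈X , liveBorn val (∈-─⁻ X∈ Y∈) v∈Y
        (inj₂ (inj₂ (u∈Y , v∈X))) → liveBorn val (∈-─⁻ X∈ Y∈) u∈Y , liveBorn val X∈ v∈X
    ; closed = λ x∈B notLive xv → ∨-true⁺ˡ _ (closed val x∈B notLive xv) }
  step-valid (clique {B} {L} {P} {X} X∈ _ _) val = record
    { disjoint = disjoint val
    ; liveBorn = liveBorn val
    ; placedBorn = λ p → case placeInside⁻ {G = G} {X} P p of λ where
        (inj₁ q)               → placedBorn val q
        (inj₂ (u∈X , v∈X , _)) → liveBorn val X∈ u∈X , liveBorn val X∈ v∈X
    ; closed = λ x∈B notLive xv → ∨-true⁺ˡ _ (closed val x∈B notLive xv) }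
  step-valid (close {X = X} X∈ allPlaced) val = record
    { disjoint = proj₂ (AllPairs-─ Disjoint-sym X∈ (disjoint val))
    ; liveBorn = liveBorn val ∘ ∈-─⁻ X∈
    ; placedBorn = placedBorn val
    ; closed = λ {x} {v} x∈B notLive xv → case x ∈? X of λ where
        (yes x∈X) → allPlaced x v x∈X xv
        (no  x∉X) → closed val x∈B (λ Z∈ x∈Z → case ∈-─⁺ X∈ Z∈ of λ where
          (inj₁ refl) → x∉X x∈Z
          (inj₂ Z∈′)  → notLive Z∈′ x∈Z) xv }

  -- Induction along the rest of the play. The first `block` or `clique` that places one of the two
  -- pairs acts on the cable containing both `x` and `y`, so its legality makes both pairs edges; if
  -- that cable is closed before, neither pair is an edge. Folds keep `x` and `y` together.
  twins : ∀ {C D} → Valid C → Star (Move G) C D → Constructed G D →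
          ∀ {X x y v} → X List.∈ live C → x ∈ X → y ∈ X → v ≢ x → v ≢ y →
          placed C x v ≡ false → placed C y v ≡ false → adj G x v ≡ adj G y v
  twins val ε (_ , _ , refl) () x∈X y∈X v≢x v≢y px py
  twins val (m@(birth _ _ _) ◅ p) con X∈ x∈X y∈X v≢x v≢y px py =
    twins (step-valid m val) p con (there X∈) x∈X y∈X v≢x v≢y px py
  twins val (m@(fold {X = Y} {Z} Y∈ Z∈) ◅ p) con X∈ x∈X y∈X v≢x v≢y px py with ∈-─⁺ Y∈ X∈
  ... | inj₁ refl = twins (step-valid m val) p con (here refl)
          (p⊆p∪q Z x∈X) (p⊆p∪q Z y∈X) v≢x v≢y px py
  ... | inj₂ X∈′ with ∈-─⁺ Z∈ X∈′
  ...   | inj₁ refl = twins (step-valid m val) p con (here refl)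
            (q⊆p∪q Y Z x∈X) (q⊆p∪q Y Z y∈X) v≢x v≢y px py
  ...   | inj₂ X∈″ = twins (step-valid m val) p con (there X∈″) x∈X y∈X v≢x v≢y px py
  twins val (m@(block {B} {L} {P} {Y} {Z} Y∈ Z∈ complete _) ◅ p) con {X} {x} {y} {v} X∈ x∈X y∈X v≢x v≢y px py
    with placeBetween Y Z P x v in px′ | placeBetween Y Z P y v in py′
  ... | false | false = twins (step-valid m val) p con X∈ x∈X y∈X v≢x v≢y px′ py′
  ... | true  | _     = trans (proj₁ both) (sym (proj₂ both))
    where
    both : adj G x v ≡ true × adj G y v ≡ true
    both with placeBetween⁻ {X = Y} {Z} P px′
    ... | inj₁ q = case trans (sym px) q of λ ()
    -- Live cables are disjoint, so the one containing `x` is `X` itself and contains `y` as well.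
    ... | inj₂ (inj₁ (x∈Y , v∈Z)) with refl ← disjoint⇒≡ (disjoint val) X∈ Y∈ x∈X x∈Y =
            complete x v x∈Y v∈Z , complete y v y∈X v∈Z
    ... | inj₂ (inj₂ (x∈Z , v∈Y)) with refl ← disjoint⇒≡ (disjoint val) X∈ (∈-─⁻ Y∈ Z∈) x∈X x∈Z =
            trans (symmetric G x v) (complete v x v∈Y x∈Z) , trans (symmetric G y v) (complete v y v∈Y y∈X)
  ... | false | true = trans (proj₁ both) (sym (proj₂ both))
    where
    both : adj G x v ≡ true × adj G y v ≡ true
    both with placeBetween⁻ {X = Y} {Z} P py′
    ... | inj₁ q = case trans (sym py) q of λ ()
    ... | inj₂ (inj₁ (y∈Y , v∈Z)) with refl ← disjoint⇒≡ (disjoint val) X∈ Y∈ y∈X y∈Y =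
            complete x v x∈X v∈Z , complete y v y∈X v∈Z
    ... | inj₂ (inj₂ (y∈Z , v∈Y)) with refl ← disjoint⇒≡ (disjoint val) X∈ (∈-─⁻ Y∈ Z∈) y∈X y∈Z =
            trans (symmetric G x v) (complete v x v∈Y x∈X) , trans (symmetric G y v) (complete v y v∈Y y∈X)
  twins val (m@(clique {B} {L} {P} {Y} Y∈ complete _) ◅ p) con {X} {x} {y} {v} X∈ x∈X y∈X v≢x v≢y px py
    with placeInside G Y P x v in px′ | placeInside G Y P y v in py′
  ... | false | false = twins (step-valid m val) p con X∈ x∈X y∈X v≢x v≢y px′ py′
  ... | true  | _ with placeInside⁻ {G = G} {Y} P px′
  ...   | inj₁ q = case trans (sym px) q of λ ()
  ...   | inj₂ (x∈Y , v∈Y , xv) with refl ← disjoint⇒≡ (disjoint val) X∈ Y∈ x∈X x∈Y =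
            -- A clique only makes distinct vertices adjacent; this is where `v ≢ y` enters.
            trans xv (sym (complete y v y∈X v∈Y (v≢y ∘ sym)))
  twins val (m@(clique {B} {L} {P} {Y} Y∈ complete _) ◅ p) con {X} {x} {y} {v} X∈ x∈X y∈X v≢x v≢y px py
      | false | true with placeInside⁻ {G = G} {Y} P py′
  ...   | inj₁ q = case trans (sym py) q of λ ()
  ...   | inj₂ (y∈Y , v∈Y , yv) with refl ← disjoint⇒≡ (disjoint val) X∈ Y∈ y∈X y∈Y =
            trans (complete x v x∈X v∈Y (v≢x ∘ sym)) (sym yv)
  twins val (m@(close Y∈ allPlaced) ◅ p) con {X} {x} {y} {v} X∈ x∈X y∈X v≢x v≢y px py with ∈-─⁺ Y∈ X∈
  ... | inj₂ X∈′ = twins (step-valid m val) p con X∈′ x∈X y∈X v≢x v≢y px py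
  ... | inj₁ refl = trans (nonadjacent x x∈X px) (sym (nonadjacent y y∈X py))
    where
    nonadjacent : ∀ z → z ∈ X → _ → adj G z v ≡ false
    nonadjacent z z∈X pz = ¬-not λ zv → case trans (sym pz) (allPlaced z v z∈X zv) of λ ()

  UnplacedCut : Config n → Subset n → Set
  UnplacedCut C X = X ⊆ born C × (∀ {x v} → x ∈ X → v ∉ X → placed C x v ≡ false)

  -- A vertex of `X` with a neighbour across the cut is in a live cable, for otherwise that edge
  -- would already be placed. Vertices of a common live cable have equal rows by `twins`, so the
  -- live cables serve as classes.
  cutrank≤live : ∀ {C D X} → Valid C → Star (Move G) C D → Constructed G D → UnplacedCut C X →
                 CutrankAtMost G (length (live C)) X
  cutrank≤live {C} {D} {X} val p con (X⊆B , unplaced) R R⊆X indep =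
    rank≤classes (adj G) indep (λ x∈R nonzero → index (cable x∈R nonzero)) same-row
    where
    cable : ∀ {x} → x ∈ R → ¬ (∀ j → j ∈ ∁ X → adj G x j ≡ false) → Any (x ∈_) (live C)
    cable {x} x∈R nonzero with Any.any? (x ∈?_) (live C)
    ... | yes x∈L = x∈L
    ... | no ¬x∈L = contradiction
            (λ j j∈∁X → ¬-not λ xj → case trans (sym (unplaced (R⊆X x∈R) (x∈∁p⇒x∉p j∈∁X)))
               (closed val (X⊆B (R⊆X x∈R)) (λ Y∈ x∈Y → ¬x∈L (List.lose Y∈ x∈Y)) xj) of λ ())
            nonzero
    same-row : ∀ {x y} (x∈ : x ∈ R) (y∈ : y ∈ R) nx ny →
               index (cable x∈ nx) ≡ index (cable y∈ ny) → ∀ j → j ∈ ∁ X → adj G x j ≡ adj G y j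
    same-row {x} {y} x∈R y∈R nx ny eq j j∈∁X
      with Y , Y∈ , x∈Y , y∈Y ← index≡⇒common (cable x∈R nx) (cable y∈R ny) eq =
      twins val p con Y∈ x∈Y y∈Y (λ { refl → j∉X (R⊆X x∈R) }) (λ { refl → j∉X (R⊆X y∈R) })
        (unplaced (R⊆X x∈R) j∉X) (unplaced (R⊆X y∈R) j∉X)
      where j∉X = x∈∁p⇒x∉p j∈∁X

  -- The bound is kept in doubled form for direct comparison with costs; it is halved only once, at
  -- the end.
  CutrankAtMostHalf : ℕ → Subset n → Set
  CutrankAtMostHalf w X = ∀ R → R ⊆ X → IndependentRows (adj G) R (∁ X) → 2 * ∣ R ∣ ≤ w

  -- A birth, block or clique already costs at least twice the number of live cables. A fold or
  -- close may cost one less, but it changes neither the born vertices nor the placed pairs, so the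
  -- same cut is passed on to the next configuration.
  cutrank≤width : ∀ {C D X} → Valid C → (p : Star (Move G) C D) → Constructed G D → UnplacedCut C X →
                  CutrankAtMostHalf (width p) X
  cutrank≤width val p₀@ε con@(_ , _ , refl) cut R R⊆X indep =
    ℕ.*-monoʳ-≤ 2 (cutrank≤live val p₀ con cut R R⊆X indep)
  cutrank≤width val p₀@(birth _ _ _ ◅ p) con cut R R⊆X indep =
    ℕ.≤-trans (ℕ.*-monoʳ-≤ 2 (cutrank≤live val p₀ con cut R R⊆X indep))
      (ℕ.≤-trans (ℕ.m≤m+n _ 1) (ℕ.m≤m⊔n _ _))
  cutrank≤width val p₀@(block _ _ _ _ ◅ p) con cut R R⊆X indep =
    ℕ.≤-trans (ℕ.*-monoʳ-≤ 2 (cutrank≤live val p₀ con cut R R⊆X indep)) (ℕ.m≤m⊔n _ _)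
  cutrank≤width val p₀@(clique _ _ _ ◅ p) con cut R R⊆X indep =
    ℕ.≤-trans (ℕ.*-monoʳ-≤ 2 (cutrank≤live val p₀ con cut R R⊆X indep)) (ℕ.m≤m⊔n _ _)
  cutrank≤width val (m@(fold _ _) ◅ p) con cut R R⊆X indep =
    ℕ.≤-trans (cutrank≤width (step-valid m val) p con cut R R⊆X indep) (ℕ.m≤n⊔m (cost m) _)
  cutrank≤width val (m@(close _ _) ◅ p) con cut R R⊆X indep =
    ℕ.≤-trans (cutrank≤width (step-valid m val) p con cut R R⊆X indep) (ℕ.m≤n⊔m (cost m) _)

  play⇒extension : ∀ {C D w} → Valid C → (p : Star (Move G) C D) → Constructed G D → width p ≤ w →
                   Extension (CutrankAtMostHalf w) (born C)
  play⇒extension val ε con _ = done (proj₁ con)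
  play⇒extension val (m@(birth {B} {L} {P} S S≢∅ S⊆∁B) ◅ p) con p≤w =
    extend (p⊆p∪q S)
      (λ Z B⊆Z Z⊆B∪S R R⊆Z indep → ℕ.≤-trans
        (cutrank≤width (step-valid m val) p con
          -- No pair was placed since the birth, so every placed pair has both ends in `B`, hence in
          -- `Z`.
          (Z⊆B∪S , λ _ v∉Z → ¬-not λ xv → v∉Z (B⊆Z (proj₂ (placedBorn val xv)))) R R⊆Z indep)
        p≤w′)
      (play⇒extension (step-valid m val) p con p≤w′)
    where p≤w′ = ℕ.m⊔n≤o⇒n≤o (cost m) _ p≤w
  play⇒extension val (m@(fold _ _) ◅ p) con p≤w =
    play⇒extension (step-valid m val) p con (ℕ.m⊔n≤o⇒n≤o (cost m) _ p≤w)
  play⇒extension val (m@(block _ _ _ _) ◅ p) con p≤w =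
    play⇒extension (step-valid m val) p con (ℕ.m⊔n≤o⇒n≤o (cost m) _ p≤w)
  play⇒extension val (m@(clique _ _ _) ◅ p) con p≤w =
    play⇒extension (step-valid m val) p con (ℕ.m⊔n≤o⇒n≤o (cost m) _ p≤w)
  play⇒extension val (m@(close _ _) ◅ p) con p≤w =
    play⇒extension (step-valid m val) p con (ℕ.m⊔n≤o⇒n≤o (cost m) _ p≤w)

  2*lrw≤width : ∀ {r D} → IsMinimum (λ k → Extension (CutrankAtMost G k) Subset.⊥) r →
                (p : Play G D) → Constructed G D → 2 * r ≤ width p
  2*lrw≤width {r} (_ , min) p con = begin
    -- Ranks are integers, so every cut along the play has rank at most `⌊ w /2⌋`, and `r` is the
    -- least such bound.
    2 * r              ≤⟨ ℕ.*-monoʳ-≤ 2 (min _ (map-extension half (play⇒extension initial-valid p con ℕ.≤-refl))) ⟩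
    2 * ⌊ w /2⌋        ≡⟨ cong (⌊ w /2⌋ +_) (ℕ.+-identityʳ _) ⟩
    ⌊ w /2⌋ + ⌊ w /2⌋  ≤⟨ ℕ.+-monoʳ-≤ ⌊ w /2⌋ (ℕ.⌊n/2⌋≤⌈n/2⌉ w) ⟩
    ⌊ w /2⌋ + ⌈ w /2⌉  ≡⟨ ℕ.⌊n/2⌋+⌈n/2⌉≡n w ⟩
    w                  ∎
    where
    open ℕ.≤-Reasoning
    w = width p
    half : ∀ {X} → CutrankAtMostHalf w X → CutrankAtMost G ⌊ w /2⌋ X
    half bound R R⊆X indep = begin
      ∣ R ∣               ≡⟨ ℕ.n≡⌊n+n/2⌋ ∣ R ∣ ⟩
      ⌊ ∣ R ∣ + ∣ R ∣ /2⌋ ≡⟨ cong (λ r → ⌊ ∣ R ∣ + r /2⌋) (sym (ℕ.+-identityʳ ∣ R ∣)) ⟩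
      ⌊ 2 * ∣ R ∣ /2⌋     ≤⟨ ℕ.⌊n/2⌋-mono (bound R R⊆X indep) ⟩
      ⌊ w /2⌋             ∎

-- From orders to plays

module _ {R : A → A → Set} where

  -- The second alternative selects two different entries in the form that `fold` takes.
  related-pair : (∀ x y → Dec (R x y)) → ∀ xs →
    AllPairs (λ x y → ¬ R x y) xs ⊎
    ∃ λ x → ∃ λ y → Σ (x List.∈ xs) λ x∈ → y List.∈ (xs ─ x∈) × R x y
  related-pair R? [] = inj₁ []
  related-pair R? (x ∷ xs) with Any.any? (R? x) xs
  ... | yes r with y , y∈ , xRy ← List.find r = inj₂ (x , y , here refl , y∈ , xRy)
  ... | no ¬r with related-pair R? xs
  ...   | inj₁ none = inj₁ (¬Any⇒All¬ xs ¬r ∷ none)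
  ...   | inj₂ (y , z , y∈ , z∈ , yRz) = inj₂ (y , z , there y∈ , there z∈ , yRz)

  lookup-unrelated : (∀ {x y} → R x y → R y x) → ∀ {xs} → AllPairs (λ x y → ¬ R x y) xs →
    ∀ i j → R (lookupₗ xs i) (lookupₗ xs j) → i ≡ j
  lookup-unrelated R-sym (r ∷ rs) zero    zero    _   = refl
  lookup-unrelated R-sym (r ∷ rs) zero    (suc j) xRy = contradiction xRy (All.lookup r (∈-lookup j))
  lookup-unrelated R-sym (r ∷ rs) (suc i) zero    xRy = contradiction (R-sym xRy) (All.lookup r (∈-lookup i))
  lookup-unrelated R-sym (r ∷ rs) (suc i) (suc j) xRy = cong suc (lookup-unrelated R-sym rs i j xRy)

length-─ : ∀ {xs : List A} {x} (x∈ : x List.∈ xs) → length xs ≡ suc (length (xs ─ x∈))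
length-─ {xs = xs} x∈ = length-removeAt′ xs (index x∈)

∨-true⁺ʳ : ∀ a {b} → b ≡ true → a ∨ b ≡ true
∨-true⁺ʳ true  _  = refl
∨-true⁺ʳ false eq = eq

Symmetric : (Fin n → Fin n → Bool) → Set
Symmetric P = ∀ u v → P u v ≡ P v u

placeBetween-symmetric : ∀ (X Y : Subset n) {P} → Symmetric P → Symmetric (placeBetween X Y P)
placeBetween-symmetric X Y P-sym u v = cong₂ _∨_ (P-sym u v)
  (trans (∨-comm (lookup X u ∧ lookup Y v) _)
    (cong₂ _∨_ (∧-comm (lookup Y u) _) (∧-comm (lookup X u) _)))

placeBetween⁺ : ∀ {X Y : Subset n} P {u v} → u ∈ X → v ∈ Y → placeBetween X Y P u v ≡ true
placeBetween⁺ P {u} {v} u∈X v∈Y =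
  ∨-true⁺ʳ (P u v) (∨-true⁺ˡ _ (cong₂ _∧_ ([]=⇒lookup u∈X) ([]=⇒lookup v∈Y)))

module _ (G : Graph n) where

  Completable : ℕ → Config n → Set
  Completable K C = Σ (Config n) λ D → Constructed G D × Σ (Star (Move G) C D) λ p → width p ≤ K

  prepend : ∀ {K C C′} (m : Move G C C′) → cost m ≤ K → Completable K C′ → Completable K C
  prepend m m≤K (D , con , p , p≤K) = D , con , m ◅ p , ℕ.⊔-lub m≤K p≤K

  Isolated : Subset n → Subset n → Set
  Isolated B X = ∀ x → x ∈ X → ∀ v → v ∉ B → adj G x v ≡ false

  -- Equality of the rows towards the unborn vertices. In particular `Similar B X X` says that the
  -- vertices of `X` share one such row.
  Similar : Subset n → Subset n → Subset n → Set
  Similar B X Y = ∀ x → x ∈ X → ∀ y → y ∈ Y → ∀ v → v ∉ B → adj G x v ≡ adj G y v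

  isolated? : ∀ B X → Dec (Isolated B X)
  isolated? B X = all? λ x → x ∈? X →-dec all? λ v → ¬? (v ∈? B) →-dec adj G x v Bool.≟ false

  similar? : ∀ B X Y → Dec (Similar B X Y)
  similar? B X Y = all? λ x → x ∈? X →-dec all? λ y → y ∈? Y →-dec
                   all? λ v → ¬? (v ∈? B) →-dec adj G x v Bool.≟ adj G y v

  Similar-sym : ∀ {B X Y} → Similar B X Y → Similar B Y X
  Similar-sym sim y y∈Y x x∈X v v∉B = sym (sim x x∈X y y∈Y v v∉B)

  -- The state of the strategy between the arrivals of two vertices: all edges among born vertices
  -- are placed. Symmetry of `placed` makes it enough to treat new edges from the side of the new
  -- vertex.
  record UpToDate (C : Config n) : Set where
    field
      nonempty : ∀ {X} → X List.∈ live C → Nonempty X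
      liveBorn : ∀ {X} → X List.∈ live C → X ⊆ born C
      similar  : ∀ {X} → X List.∈ live C → Similar (born C) X X
      closed   : ∀ {x} → x ∈ born C → (∀ {X} → X List.∈ live C → x ∉ X) →
                 ∀ v → v ∉ born C → adj G x v ≡ false
      allPlaced : ∀ {x v} → x ∈ born C → v ∈ born C → adj G x v ≡ true → placed C x v ≡ true
      symmetricPlaced : Symmetric (placed C)

  open UpToDate

  Reduced : Subset n → List (Subset n) → Set
  Reduced B L = All (λ X → ¬ Isolated B X) L × AllPairs (λ X Y → ¬ Similar B X Y) L

  fold-upToDate : ∀ {B L P X Y} (X∈ : X List.∈ L) (Y∈ : Y List.∈ (L ─ X∈)) → Similar B X Y →
                  UpToDate (config B L P) → UpToDate (config B ((X ∪ Y) ∷ ((L ─ X∈) ─ Y∈)) P)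
  fold-upToDate {B} {L} {P} {X} {Y} X∈ Y∈ sim utd = record
    { nonempty = λ where
        (here refl) → case nonempty utd X∈ of λ { (x , x∈X) → x , p⊆p∪q Y x∈X }
        (there Z∈)  → nonempty utd (∈-─⁻ X∈ (∈-─⁻ Y∈ Z∈))
    ; liveBorn = λ where
        (here refl) x∈ → case x∈p∪q⁻ X Y x∈ of λ where
          (inj₁ x∈X) → liveBorn utd X∈ x∈X
          (inj₂ x∈Y) → liveBorn utd (∈-─⁻ X∈ Y∈) x∈Y
        (there Z∈) → liveBorn utd (∈-─⁻ X∈ (∈-─⁻ Y∈ Z∈))
    ; similar = λ where
        (here refl) x x∈ y y∈ → case x∈p∪q⁻ X Y x∈ , x∈p∪q⁻ X Y y∈ of λ where
          (inj₁ x∈X , inj₁ y∈X) → similar utd X∈ x x∈X y y∈X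
          (inj₁ x∈X , inj₂ y∈Y) → sim x x∈X y y∈Y
          (inj₂ x∈Y , inj₁ y∈X) → Similar-sym sim x x∈Y y y∈X
          (inj₂ x∈Y , inj₂ y∈Y) → similar utd (∈-─⁻ X∈ Y∈) x x∈Y y y∈Y
        (there Z∈) → similar utd (∈-─⁻ X∈ (∈-─⁻ Y∈ Z∈))
    ; closed = λ x∈B notLive → closed utd x∈B λ Z∈ x∈Z → case ∈-─⁺ X∈ Z∈ of λ where
        (inj₁ refl) → notLive (here refl) (p⊆p∪q Y x∈Z)
        (inj₂ Z∈′)  → case ∈-─⁺ Y∈ Z∈′ of λ where
          (inj₁ refl) → notLive (here refl) (q⊆p∪q X Y x∈Z)
          (inj₂ Z∈″)  → notLive (there Z∈″) x∈Z
    ; allPlaced = allPlaced utd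
    ; symmetricPlaced = symmetricPlaced utd }

  close-upToDate : ∀ {B L P X} (X∈ : X List.∈ L) → Isolated B X →
                   UpToDate (config B L P) → UpToDate (config B (L ─ X∈) P)
  close-upToDate {B} {L} {P} {X} X∈ iso utd = record
    { nonempty = nonempty utd ∘ ∈-─⁻ X∈
    ; liveBorn = liveBorn utd ∘ ∈-─⁻ X∈
    ; similar  = similar utd ∘ ∈-─⁻ X∈
    ; closed = λ {x} x∈B notLive → case x ∈? X of λ where
        (yes x∈X) → iso x x∈X
        (no  x∉X) → closed utd x∈B λ Z∈ x∈Z → case ∈-─⁺ X∈ Z∈ of λ where
          (inj₁ refl) → x∉X x∈Z
          (inj₂ Z∈′)  → notLive Z∈′ x∈Z
    ; allPlaced = allPlaced utd
    ; symmetricPlaced = symmetricPlaced utd }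

  -- Each close or fold removes one cable, so the recursion is on the length `l` and no move costs
  -- more than `2 * l`. The play is built by prepending, hence the rest of it enters as a
  -- continuation.
  reduce : ∀ {K B P} l L → length L ≡ l → 2 * l ≤ K → UpToDate (config B L P) →
           (∀ L′ → UpToDate (config B L′ P) → Reduced B L′ → Completable K (config B L′ P)) →
           Completable K (config B L P)
  reduce {K} {B} {P} l L L≡l l≤K utd continue with Any.any? (isolated? B) L
  ... | yes isolated with X , X∈ , iso ← List.find isolated with l
  ...   | zero  with () ← trans (sym L≡l) (length-─ X∈)
  -- The close is legal: edges to born vertices are placed, and an isolated cable has none to unborn
  -- ones.
  ...   | suc l′ = prepend (close X∈ λ x v x∈X xv → case v ∈? B of λ where
              (yes v∈B) → allPlaced utd (liveBorn utd X∈ x∈X) v∈B xv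
              (no v∉B)  → case trans (sym xv) (iso x x∈X v v∉B) of λ ())
            (ℕ.≤-trans (ℕ.m∸n≤m _ 1) (subst (λ l → 2 * l ≤ K) (sym L≡l) l≤K))
            (reduce l′ (L ─ X∈) (ℕ.suc-injective (trans (sym (length-─ X∈)) L≡l))
              (ℕ.≤-trans (ℕ.*-monoʳ-≤ 2 (ℕ.n≤1+n l′)) l≤K) (close-upToDate X∈ iso utd) continue)
  reduce {K} {B} {P} l L L≡l l≤K utd continue | no ¬isolated with related-pair (similar? B) L
  ... | inj₁ dissimilar = continue L utd (¬Any⇒All¬ L ¬isolated , dissimilar)
  ... | inj₂ (X , Y , X∈ , Y∈ , sim) with l
  ...   | zero  with () ← trans (sym L≡l) (length-─ X∈)
  ...   | suc l′ = prepend (fold X∈ Y∈)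
            (ℕ.≤-trans (ℕ.m∸n≤m _ 1) (subst (λ l → 2 * l ≤ K) (sym L≡l) l≤K))
            (reduce l′ _ (trans (sym (length-─ Y∈)) (ℕ.suc-injective (trans (sym (length-─ X∈)) L≡l)))
              (ℕ.≤-trans (ℕ.*-monoʳ-≤ 2 (ℕ.n≤1+n l′)) l≤K) (fold-upToDate X∈ Y∈ sim utd) continue)

  -- One representative per cable gives pairwise distinct nonzero rows of the cut matrix, and the
  -- zero row makes the inequality strict.
  reduced⇒length<2^ : ∀ {k C} → CutrankAtMost G k (born C) → UpToDate C → Reduced (born C) (live C) →
                      length (live C) < 2 ^ k
  reduced⇒length<2^ {k} {C} bound utd (¬isolated , dissimilar)
    with r , (R , R⊆B , indep , refl) , max ← rank (adj G) (born C) (∁ (born C)) =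
    ℕ.≤-trans
      (distinct-nonzero-rows (adj G) R⊆B indep
        (λ R′ R′⊆B indep′ → max _ (R′ , R′⊆B , indep′ , refl))
        representative (λ i → liveBorn utd (∈-lookup i) (representative-∈ i))
        (λ i zero-row → All.lookup ¬isolated (∈-lookup i) λ x x∈ v v∉B →
           trans (similar utd (∈-lookup i) x x∈ _ (representative-∈ i) v v∉B)
                 (zero-row v (x∉p⇒x∈∁p v∉B)))
        (λ i j same → lookup-unrelated (λ {X} {Y} → Similar-sym {born C} {X} {Y}) dissimilar i j λ x x∈ y y∈ v v∉B →
           trans (similar utd (∈-lookup i) x x∈ _ (representative-∈ i) v v∉B)
             (trans (same v (x∉p⇒x∈∁p v∉B))
                    (similar utd (∈-lookup j) _ (representative-∈ j) y y∈ v v∉B))))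
      (ℕ.^-monoʳ-≤ 2 (bound R R⊆B indep))
    where
    representative : Fin (length (live C)) → Fin n
    representative i = proj₁ (nonempty utd (∈-lookup i))
    representative-∈ : ∀ i → representative i ∈ lookupₗ (live C) i
    representative-∈ i = proj₂ (nonempty utd (∈-lookup i))

  module _ {K B L v} (v∉B : v ∉ B) (similarL : ∀ {X} → X List.∈ L → Similar B X X)
           (affordable : 2 * suc (length L) ≤ K) where

    -- `B` is the born set before `v`, while `B′` is the current one. As `v` was unborn with respect
    -- to `B`, it is adjacent to all of a cable or to none of it, so at most one block per cable
    -- suffices.
    place-blocks : ∀ Ys → (∀ {Y} → Y List.∈ Ys → Y List.∈ L) → ∀ {B′} P → Symmetric P →
      (∀ P′ → Symmetric P′ → (∀ {x y} → P x y ≡ true → P′ x y ≡ true) →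
        (∀ {Y y} → Y List.∈ Ys → y ∈ Y → adj G v y ≡ true → P′ v y ≡ true) →
        Completable K (config B′ (⁅ v ⁆ ∷ L) P′)) →
      Completable K (config B′ (⁅ v ⁆ ∷ L) P)
    place-blocks [] Ys⊆L P P-sym continue = continue P P-sym id λ ()
    place-blocks (Y ∷ Ys) Ys⊆L P P-sym continue
      with any? (λ y → y ∈? Y ×-dec adj G v y Bool.≟ true ×-dec P v y Bool.≟ false)
    -- Every edge from `v` to `Y` is placed already, and no move is made.
    ... | no none = place-blocks Ys (Ys⊆L ∘ there) P P-sym λ P′ P′-sym P≤P′ blocks →
            continue P′ P′-sym P≤P′ λ where
              (here refl) y∈Y vy → P≤P′ (decidable-stable (P v _ Bool.≟ true)
                λ ¬p → none (_ , y∈Y , vy , ¬-not ¬p))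
              (there Y∈) → blocks Y∈
    ... | yes (y , y∈Y , vy , unplaced) = prepend
            (block {X = ⁅ v ⁆} {Y} (here refl) (Ys⊆L (here refl)) complete (v , y , x∈⁅x⁆ v , y∈Y , unplaced))
            affordable
            (place-blocks Ys (Ys⊆L ∘ there) (placeBetween ⁅ v ⁆ Y P) (placeBetween-symmetric ⁅ v ⁆ Y P-sym)
              λ P′ P′-sym P≤P′ blocks → continue P′ P′-sym (P≤P′ ∘ ∨-true⁺ˡ _) λ where
                (here refl) z∈Y _ → P≤P′ (placeBetween⁺ P (x∈⁅x⁆ v) z∈Y)
                (there Y∈) → blocks Y∈)
      where
      complete : ∀ x z → x ∈ ⁅ v ⁆ → z ∈ Y → adj G x z ≡ true
      complete x z x∈v z∈Y with refl ← x∈⁅y⁆⇒x≡y v x∈v =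
        trans (symmetric G v z) (trans (similarL (Ys⊆L (here refl)) z z∈Y y y∈Y v v∉B)
          (trans (symmetric G y v) vy))

  -- The only new edges join `v` to older vertices. Those into live cables are supplied by the
  -- blocks, and a vertex in no live cable is not adjacent to `v`, which was unborn.
  add-upToDate : ∀ {B L P P′ v} → v ∉ B → UpToDate (config B L P) → Symmetric P′ →
    (∀ {x y} → P x y ≡ true → P′ x y ≡ true) →
    (∀ {Y y} → Y List.∈ L → y ∈ Y → adj G v y ≡ true → P′ v y ≡ true) →
    UpToDate (config (B ∪ ⁅ v ⁆) (⁅ v ⁆ ∷ L) P′)
  add-upToDate {B} {L} {P} {P′} {v} v∉B utd P′-sym P≤P′ blocks = record
    { nonempty = λ where
        (here refl) → v , x∈⁅x⁆ v
        (there X∈)  → nonempty utd X∈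
    ; liveBorn = λ where
        (here refl) → q⊆p∪q B ⁅ v ⁆
        (there X∈)  → p⊆p∪q ⁅ v ⁆ ∘ liveBorn utd X∈
    ; similar = λ where
        (here refl) x x∈ y y∈ u u∉ → cong (λ x → adj G x u)
          (trans (x∈⁅y⁆⇒x≡y v x∈) (sym (x∈⁅y⁆⇒x≡y v y∈)))
        (there X∈) x x∈ y y∈ u u∉ → similar utd X∈ x x∈ y y∈ u (u∉ ∘ p⊆p∪q ⁅ v ⁆)
    ; closed = λ x∈ notLive u u∉ → case x∈p∪q⁻ B ⁅ v ⁆ x∈ of λ where
        (inj₁ x∈B) → closed utd x∈B (notLive ∘ there) u (u∉ ∘ p⊆p∪q ⁅ v ⁆)
        (inj₂ x∈v) → contradiction x∈v (notLive (here refl))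
    ; allPlaced = λ {x} {y} x∈ y∈ xy → case x∈p∪q⁻ B ⁅ v ⁆ x∈ , x∈p∪q⁻ B ⁅ v ⁆ y∈ of λ where
        (inj₁ x∈B , inj₁ y∈B) → P≤P′ (allPlaced utd x∈B y∈B xy)
        (inj₁ x∈B , inj₂ y∈v) → case x∈⁅y⁆⇒x≡y v y∈v of λ where
          refl → trans (P′-sym x v) (new x∈B (trans (symmetric G v x) xy))
        (inj₂ x∈v , inj₁ y∈B) → case x∈⁅y⁆⇒x≡y v x∈v of λ where
          refl → new y∈B xy
        (inj₂ x∈v , inj₂ y∈v) → case x∈⁅y⁆⇒x≡y v x∈v , x∈⁅y⁆⇒x≡y v y∈v of λ where
          (refl , refl) → case trans (sym xy) (loopless G v) of λ ()
    ; symmetricPlaced = P′-sym }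
    where
    new : ∀ {y} → y ∈ B → adj G v y ≡ true → P′ v y ≡ true
    new {y} y∈B vy with Any.any? (y ∈?_) L
    ... | yes y∈L with Y , Y∈ , y∈Y ← List.find y∈L = blocks Y∈ y∈Y vy
    ... | no ¬y∈L = case trans (sym vy) (trans (symmetric G v y)
            (closed utd y∈B (λ Y∈ y∈Y → ¬y∈L (List.lose Y∈ y∈Y)) v v∉B)) of λ ()

  -- Each vertex is born alone, joined to the live cables by blocks, and followed by a reduction.
  -- The strict bound on `L` leaves room for the newborn cable, and the cutrank of the next prefix
  -- restores it.
  extension⇒completable : ∀ {k B L P} → Extension (CutrankAtMost G k) B → UpToDate (config B L P) →
    Reduced B L → length L < 2 ^ k → Completable (2 * 2 ^ k) (config B L P)
  extension⇒completable {B = B} {[]} {P} (done full) utd reduced L<2^k =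
    config B [] P , (full , (λ u v → allPlaced utd (full u) (full v)) , refl) , ε , z≤n
  -- Once all vertices are born every cable is isolated, so a reduced configuration has no live
  -- cable.
  extension⇒completable {L = X ∷ L} (done full) utd (¬isolated ∷ _ , _) L<2^k =
    contradiction (λ x x∈X v v∉B → contradiction (full v) v∉B) ¬isolated
  extension⇒completable {k} {B} {L} {P} (add v v∉B bound e) utd reduced L<2^k =
    prepend (birth ⁅ v ⁆ (v , x∈⁅x⁆ v) λ x∈v → subst (_∈ ∁ B) (sym (x∈⁅y⁆⇒x≡y v x∈v)) (x∉p⇒x∈∁p v∉B))
      (begin
        2 * length L + 1     ≤⟨ ℕ.+-monoʳ-≤ (2 * length L) (ℕ.n≤1+n 1) ⟩
        2 * length L + 2     ≡⟨ ℕ.+-comm (2 * length L) 2 ⟩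
        2 + 2 * length L     ≡⟨ sym (ℕ.*-suc 2 (length L)) ⟩
        2 * suc (length L)   ≤⟨ affordable ⟩
        2 * 2 ^ k            ∎)
      (place-blocks v∉B (similar utd) affordable L id P (symmetricPlaced utd)
        λ P′ P′-sym P≤P′ blocks →
          reduce (suc (length L)) (⁅ v ⁆ ∷ L) refl affordable (add-upToDate v∉B utd P′-sym P≤P′ blocks)
            λ L′ utd′ reduced′ →
              extension⇒completable e utd′ reduced′ (reduced⇒length<2^ bound utd′ reduced′))
    where
    open ℕ.≤-Reasoning
    affordable : 2 * suc (length L) ≤ 2 * 2 ^ k
    affordable = ℕ.*-monoʳ-≤ 2 L<2^k

  initial-completable : ∀ {k} → Extension (CutrankAtMost G k) Subset.⊥ → Completable (2 * 2 ^ k) initial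
  initial-completable {k} e = extension⇒completable e
    (record { nonempty = λ () ; liveBorn = λ () ; similar = λ () ; closed = λ x∈⊥ → contradiction x∈⊥ ∉⊥
            ; allPlaced = λ x∈⊥ → contradiction x∈⊥ ∉⊥ ; symmetricPlaced = λ _ _ → refl })
    ([] , []) (ℕ.m^n>0 2 k)

-- Existence of an optimal play

-- A move can only be formed from a proof of its legality, so the second decision must be allowed to
-- depend on the first.
_×-dec′_ : Dec A → (A → Dec B) → Dec (A × B)
yes a ×-dec′ b? = map′ (a ,_) proj₂ (b? a)
no ¬a ×-dec′ b? = no (¬a ∘ proj₁)

any∈? : ∀ (xs : List A) {Q : ∀ x → x List.∈ xs → Set} → (∀ x x∈ → Dec (Q x x∈)) →
        Dec (∃ λ x → Σ (x List.∈ xs) (Q x))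
any∈? []       Q? = no λ ()
any∈? (x ∷ xs) Q? = map′
  (λ where
    (inj₁ q)            → x , here refl , q
    (inj₂ (y , y∈ , q)) → y , there y∈ , q)
  (λ where
    (_ , here refl , q) → inj₁ q
    (y , there y∈ , q)  → inj₂ (y , y∈ , q))
  (Q? x (here refl) ⊎-dec any∈? xs (λ y y∈ → Q? y (there y∈)))

-- Pairs of vertices are coded in `Fin (n * n)` so that they can be counted by `∣_∣`.
unplaced : (Fin n → Fin n → Bool) → Subset (n * n)
unplaced {n} P = tabulate (not ∘ uncurry P ∘ remQuot n)

unplaced-shrinks : ∀ {P P′ : Fin n → Fin n → Bool} {x y} →
  (∀ {u v} → P u v ≡ true → P′ u v ≡ true) → P x y ≡ false → P′ x y ≡ true →
  ∣ unplaced P′ ∣ < ∣ unplaced P ∣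
unplaced-shrinks {n} {P} {P′} {x} {y} P≤P′ pxy p′xy = p⊂q⇒∣p∣<∣q∣
  ( (λ i∈ → ∈-tabulate⁺ (not-mono P≤P′ (∈-tabulate⁻ i∈)))
  , combine x y
  , ∈-tabulate⁺ (trans (cong (not ∘ uncurry P) (remQuot-combine x y)) (cong not pxy))
  , λ i∈ → case trans (sym (∈-tabulate⁻ i∈))
             (trans (cong (not ∘ uncurry P′) (remQuot-combine x y)) (cong not p′xy)) of λ ())
  where
  not-mono : ∀ {a b} → (a ≡ true → b ≡ true) → not b ≡ true → not a ≡ true
  not-mono {false} {_}     _   _ = refl
  not-mono {true}  {false} imp _ = case imp refl of λ ()

-- The factor 2 pays for births: a birth adds one live cable but uses up at least one unborn vertex.
-- The other moves lower the second or the third summand.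
measure : Config n → ℕ
measure (config B L P) = 2 * ∣ ∁ B ∣ + length L + ∣ unplaced P ∣

module _ (G : Graph n) where

  measure-decreases : ∀ {C D} → Move G C D → measure D < measure C
  measure-decreases (birth {B} {L} {P} S (s , s∈S) S⊆∁B) = begin
    suc (2 * ∣ ∁ (B ∪ S) ∣ + suc (length L) + u)   ≡⟨ cong (λ k → suc (k + u)) (ℕ.+-suc (2 * ∣ ∁ (B ∪ S) ∣) (length L)) ⟩
    2 + 2 * ∣ ∁ (B ∪ S) ∣ + length L + u           ≡⟨ cong (λ k → k + length L + u) (sym (ℕ.*-suc 2 ∣ ∁ (B ∪ S) ∣)) ⟩
    2 * suc ∣ ∁ (B ∪ S) ∣ + length L + u           ≤⟨ ℕ.+-monoˡ-≤ u (ℕ.+-monoˡ-≤ (length L) (ℕ.*-monoʳ-≤ 2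
      (p⊂q⇒∣p∣<∣q∣ (p⊂q⇒∁p⊃∁q (p⊆p∪q S , s , q⊆p∪q B S s∈S , x∈∁p⇒x∉p (S⊆∁B s∈S)))))) ⟩
    2 * ∣ ∁ B ∣ + length L + u                     ∎
    where
    open ℕ.≤-Reasoning
    u = ∣ unplaced P ∣
  measure-decreases (fold {B} {L} {P} X∈ Y∈) =
    ℕ.+-monoˡ-< ∣ unplaced P ∣ (ℕ.+-monoʳ-< (2 * ∣ ∁ B ∣)
      (ℕ.≤-reflexive (sym (trans (length-─ X∈) (cong suc (length-─ Y∈))))))
  measure-decreases (block {B} {L} {P} {X} {Y} X∈ Y∈ _ (x , y , x∈X , y∈Y , pxy)) =
    ℕ.+-monoʳ-< (2 * ∣ ∁ B ∣ + length L)
      (unplaced-shrinks {P = P} (∨-true⁺ˡ _) pxy (placeBetween⁺ P x∈X y∈Y))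
  measure-decreases (clique {B} {L} {P} {X} X∈ complete (x , y , x∈X , y∈X , x≢y , pxy)) =
    ℕ.+-monoʳ-< (2 * ∣ ∁ B ∣ + length L)
      (unplaced-shrinks {P = P} {x = x} {y} (∨-true⁺ˡ _) pxy (∨-true⁺ʳ (P x y)
        (cong₂ _∧_ ([]=⇒lookup x∈X) (cong₂ _∧_ ([]=⇒lookup y∈X) (complete x y x∈X y∈X x≢y)))))
  measure-decreases (close {B} {L} {P} X∈ _) =
    ℕ.+-monoˡ-< ∣ unplaced P ∣ (ℕ.+-monoʳ-< (2 * ∣ ∁ B ∣) (ℕ.≤-reflexive (sym (length-─ X∈))))

  -- `Q` sees only the target and the cost, which do not depend on the legality proofs, so one proof
  -- per choice of cables is enough.
  someMove? : ∀ {C} {Q : Config n → ℕ → Set} → (∀ {D} (m : Move G C D) → Dec (Q D (cost m))) →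
              Dec (∃ λ D → Σ (Move G C D) λ m → Q D (cost m))
  someMove? {config B L P} {Q} Q? = map′
    (λ where
      (inj₁ (S , (S≢∅ , S⊆∁B) , q)) → _ , birth S S≢∅ (S⊆∁B _) , q
      (inj₂ (inj₁ (X , X∈ , Y , Y∈ , q))) → _ , fold X∈ Y∈ , q
      (inj₂ (inj₂ (inj₁ (X , X∈ , Y , Y∈ , (complete , new) , q)))) → _ , block X∈ Y∈ complete new , q
      (inj₂ (inj₂ (inj₂ (inj₁ (X , X∈ , (complete , new) , q))))) → _ , clique X∈ complete new , q
      (inj₂ (inj₂ (inj₂ (inj₂ (X , X∈ , allPlaced , q))))) → _ , close X∈ allPlaced , q)
    (λ where
      (_ , birth S S≢∅ S⊆∁B , q) → inj₁ (S , (S≢∅ , λ _ → S⊆∁B) , q)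
      (_ , fold X∈ Y∈ , q) → inj₂ (inj₁ (_ , X∈ , _ , Y∈ , q))
      (_ , block X∈ Y∈ complete new , q) → inj₂ (inj₂ (inj₁ (_ , X∈ , _ , Y∈ , (complete , new) , q)))
      (_ , clique X∈ complete new , q) → inj₂ (inj₂ (inj₂ (inj₁ (_ , X∈ , (complete , new) , q))))
      (_ , close X∈ allPlaced , q) → inj₂ (inj₂ (inj₂ (inj₂ (_ , X∈ , allPlaced , q)))))
    (birth? ⊎-dec fold? ⊎-dec block? ⊎-dec clique? ⊎-dec close?)
    where
    ℓ = length L
    birth? : Dec (∃ λ S → (Nonempty S × (∀ x → x ∈ S → x ∈ ∁ B)) ×
                          Q (config (B ∪ S) (S ∷ L) P) (2 * ℓ + 1))
    birth? = anySubset? λ S → (nonempty? S ×-dec all? λ x → x ∈? S →-dec x ∈? ∁ B)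
      ×-dec′ λ (S≢∅ , S⊆∁B) → Q? (birth S S≢∅ (S⊆∁B _))
    fold? : Dec (∃ λ X → Σ (X List.∈ L) λ X∈ → ∃ λ Y → Σ (Y List.∈ (L ─ X∈)) λ Y∈ →
                 Q (config B ((X ∪ Y) ∷ ((L ─ X∈) ─ Y∈)) P) (2 * ℓ ∸ 1))
    fold? = any∈? L λ X X∈ → any∈? (L ─ X∈) λ Y Y∈ → Q? (fold X∈ Y∈)
    block? : Dec (∃ λ X → Σ (X List.∈ L) λ X∈ → ∃ λ Y → Y List.∈ (L ─ X∈) ×
                  ((∀ x y → x ∈ X → y ∈ Y → adj G x y ≡ true) ×
                   (∃ λ x → ∃ λ y → x ∈ X × y ∈ Y × P x y ≡ false)) ×
                  Q (config B L (placeBetween X Y P)) (2 * ℓ))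
    block? = any∈? L λ X X∈ → any∈? (L ─ X∈) λ Y Y∈ →
      ((all? λ x → all? λ y → x ∈? X →-dec y ∈? Y →-dec adj G x y Bool.≟ true) ×-dec
       (any? λ x → any? λ y → x ∈? X ×-dec y ∈? Y ×-dec P x y Bool.≟ false))
      ×-dec′ λ (complete , new) → Q? (block X∈ Y∈ complete new)
    clique? : Dec (∃ λ X → X List.∈ L ×
                   ((∀ x y → x ∈ X → y ∈ X → x ≢ y → adj G x y ≡ true) ×
                    (∃ λ x → ∃ λ y → x ∈ X × y ∈ X × x ≢ y × P x y ≡ false)) ×
                   Q (config B L (placeInside G X P)) (2 * ℓ))
    clique? = any∈? L λ X X∈ →
      ((all? λ x → all? λ y → x ∈? X →-dec y ∈? X →-dec ¬? (x Fin.≟ y) →-dec adj G x y Bool.≟ true) ×-dec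
       (any? λ x → any? λ y → x ∈? X ×-dec y ∈? X ×-dec ¬? (x Fin.≟ y) ×-dec P x y Bool.≟ false))
      ×-dec′ λ (complete , new) → Q? (clique X∈ complete new)
    close? : Dec (∃ λ X → Σ (X List.∈ L) λ X∈ →
                  (∀ x v → x ∈ X → adj G x v ≡ true → P x v ≡ true) ×
                  Q (config B (L ─ X∈) P) (2 * ℓ ∸ 1))
    close? = any∈? L λ X X∈ →
      (all? λ x → all? λ v → x ∈? X →-dec adj G x v Bool.≟ true →-dec P x v Bool.≟ true)
      ×-dec′ λ allPlaced → Q? (close X∈ allPlaced)

  constructed? : ∀ C → Dec (Constructed G C)
  constructed? C = all? (_∈? born C) ×-dec
    all? (λ u → all? λ v → adj G u v Bool.≟ true →-dec placed C u v Bool.≟ true) ×-dec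
    empty? (live C)
    where
    empty? : ∀ (L : List (Subset n)) → Dec (L ≡ [])
    empty? []      = yes refl
    empty? (_ ∷ _) = no λ ()

  completable? : ∀ K C → Dec (Completable G K C)
  -- One unit above the measure, so that the fuel is positive at every configuration reached.
  completable? K C = go (suc (measure C)) C ℕ.≤-refl
    where
    go : ∀ fuel C → measure C < fuel → Dec (Completable G K C)
    go (suc fuel) C C<fuel = map′
      (λ where
        (inj₁ con)                   → C , con , ε , z≤n
        (inj₂ (D , m , m≤K , rest)) → prepend G m m≤K rest)
      (λ where
        (_ , con , ε , _)         → inj₁ con
        (D , con , m ◅ p , mp≤K) → inj₂ (_ , m , ℕ.m⊔n≤o⇒m≤o (cost m) _ mp≤K ,
                                           D , con , p , ℕ.m⊔n≤o⇒n≤o (cost m) _ mp≤K))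
      (constructed? C ⊎-dec someMove? {C} {λ D c → c ≤ K × Completable G K D} (λ {D} m →
        cost m ℕ.≤? K ×-dec go fuel D (ℕ.≤-trans (measure-decreases m) (s≤s⁻¹ C<fuel))))

  -- The least upper bound on widths is attained: the width of the play found is itself such a
  -- bound.
  minimum⇒lsfw : ∀ {s} → IsMinimum (λ K → Completable G K initial) s → IsLsfw G s
  minimum⇒lsfw {s} ((D , con , p , p≤s) , min) =
    (D , con , p , ℕ.≤-antisym p≤s (min (width p) (D , con , p , ℕ.≤-refl))) ,
    λ { k (D , con , p , p≡k) → min k (D , con , p , ℕ.≤-reflexive p≡k) }

  least-completable : ∀ {K} → Completable G K initial →
    ∃ (IsMinimum (λ K → Completable G K initial))
  least-completable {K} = least (λ K → completable? K initial) K

-- Combination of the two bounds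

bounds : ∀ (G : Graph n) {r s} →
  IsLrw G r → IsMinimum (λ k → Extension (CutrankAtMost G k) Subset.⊥) r →
  IsMinimum (λ K → Completable G K initial) s →
  ∃₂ λ (lrw lsfw : ℕ) →
    IsLrw G lrw ×
    IsLsfw G lsfw ×
    2 * lrw ≤ lsfw ×
    lsfw ≤ 2 ^ (lrw + 1) ×
    (lrw ≤ 1 → lsfw ≤ 4) ×
    (lrw ≤ 2 → lsfw ≤ 8)
bounds G {r} {s} isLrw minimal@(e , _) cheapest@((D , con , p , p≤s) , cheapest≤) =
  r , s , isLrw , minimum⇒lsfw G cheapest , ℕ.≤-trans (2*lrw≤width G minimal p con) p≤s , upper ,
  (λ r≤1 → ℕ.≤-trans upper (ℕ.^-monoʳ-≤ 2 (ℕ.+-monoˡ-≤ 1 r≤1))) ,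
  (λ r≤2 → ℕ.≤-trans upper (ℕ.^-monoʳ-≤ 2 (ℕ.+-monoˡ-≤ 1 r≤2)))
  where
  upper : s ≤ 2 ^ (r + 1)
  -- `2 * 2 ^ r` is `2 ^ (1 + r)` by definition; only the exponent has to be commuted.
  upper = subst (λ k → s ≤ 2 ^ k) (ℕ.+-comm 1 r) (cheapest≤ (2 * 2 ^ r) (initial-completable G e))

corollary3p9 : ∀ (n : ℕ) (G : Graph n) →
    ∃₂ λ (lrw lsfw : ℕ) →
    IsLrw G lrw ×
    IsLsfw G lsfw ×
    2 * lrw ≤ lsfw ×
    lsfw ≤ 2 ^ (lrw + 1) ×
    (lrw ≤ 1 → lsfw ≤ 4) ×
    (lrw ≤ 2 → lsfw ≤ 8)
corollary3p9 n G =
  let r , isLrw , minimal = linearRankWidth G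
      s , cheapest        = least-completable G (initial-completable G (proj₁ minimal))
  in bounds G isLrw minimal cheapest
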